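{- Let $q$ be a prime power and $n\geq 1$. Then $$\sum_{i=0}^{n}{n\brack i}_q^2(-1)^iW_i(q)=0,$$ where ${n\brack i}_q=\frac{[n]_q!}{[i]_q![n-i]_q!}$ with $[k]_q!=\prod_{j=1}^k(1+q+\dots+q^{j-1})$, $W_0(q)=1$, and for $i\geq1$, $W_i(q)$ is the number of descending maximal chains of the Segre product poset $B_i(q)\circ_\rho B_i(q)$ with respect to the edge labeling described in the context.
   Context: $B_i(q)$ is the lattice of subspaces of $\mathbb{F}_q^i$ ordered by inclusion, with rank function $\rho(W)=\dim W$. The Segre product $B_i(q)\circ_\rho B_i(q)$ is the subposet of $B_i(q)\times B_i(q)$ (componentwise order) consisting of pairs $(X_1,X_2)$ with $\dim X_1=\dim X_2$. Edge labeling of $B_i(q)$: for a one-dimensional subspace $X$, let $f(X)$ be the index of the rightmost nonzero coordinate of a nonzero vector of $X$; for a subspace $X$ let $A(X)$ be the set of one-dimensional subspaces contained in $X$; for a cover $X\lessdot Y$, the set $f(A(Y))\setminus f(A(X))$ has exactly one element, which is the label $\lambda(X,Y)\in[i]$. The Segre product is labeled by $\lambda((X_1,X_2),(Y_1,Y_2))=(\lambda(X_1,Y_1),\lambda(X_2,Y_2))\in[i]\times[i]$, where $[i]\times[i]$ has the product order $(a,b)\le(c,d)$ iff $a\le c$ and $b\le d$. A maximal chain with label sequence $\lambda_1,\dots,\lambda_i$ is descending if there is no $j$ with $\lambda_j<\lambda_{j+1}$ in this order. -}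

module Defs where

open import Level using (0ℓ) renaming (suc to lsuc)
open import Data.Nat as ℕ using (ℕ; zero; suc; _∸_; NonZero)
open import Data.Nat.Properties using (m*n≢0)
open import Data.Nat.Primality using (Prime)
open import Data.Fin as Fin using (Fin)
open import Data.Integer as ℤ using (ℤ; +_; -1ℤ)
open import Data.List using (List; map; upTo; foldr)
open import Data.Product using (Σ; ∃; ∃-syntax; _×_; _,_; proj₁; proj₂)
open import Relation.Binary.PropositionalEquality using (_≡_; _≢_)
open import Relation.Binary.Bundles using (Setoid)
open import Relation.Nullary using (¬_)
open import Algebra.Structures using (IsCommutativeRing)
open import Function.Bundles using (_↔_; Inverse)

IsPrimePower : ℕ → Set
IsPrimePower q = ∃[ p ] ∃[ k ] (Prime p × 1 ℕ.≤ k × q ≡ p ℕ.^ k)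

record FiniteField (q : ℕ) : Set₁ where
  field
    Carrier : Set
    _+_ _*_ : Carrier → Carrier → Carrier
    -_ : Carrier → Carrier
    0# 1# : Carrier
    isCommutativeRing : IsCommutativeRing _≡_ _+_ _*_ -_ 0# 1#
    0≢1 : 0# ≢ 1#
    inverse : ∀ x → x ≢ 0# → ∃[ y ] (x * y ≡ 1#)
    card : Fin q ↔ Carrier

module Lin {q : ℕ} (𝔽 : FiniteField q) (i : ℕ) where
  open FiniteField 𝔽

  Vec : Set
  Vec = Fin i → Carrier

  _≈ᵥ_ : Vec → Vec → Set
  u ≈ᵥ v = ∀ k → u k ≡ v k

  0ᵥ : Vec
  0ᵥ _ = 0#

  _+ᵥ_ : Vec → Vec → Vec
  (u +ᵥ v) k = u k + v k

  _·ᵥ_ : Carrier → Vec → Vec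
  (a ·ᵥ v) k = a * v k

  ΣF : ∀ {d} → (Fin d → Carrier) → Carrier
  ΣF {zero}  f = 0#
  ΣF {suc d} f = f Fin.zero + ΣF (λ j → f (Fin.suc j))

  lincomb : ∀ {d} → (Fin d → Carrier) → (Fin d → Vec) → Vec
  lincomb c b k = ΣF (λ j → c j * b j k)

  record Subspace : Set₁ where
    field
      _∋_   : Vec → Set
      resp  : ∀ {u v} → u ≈ᵥ v → _∋_ u → _∋_ v
      has0  : _∋_ 0ᵥ
      close+ : ∀ {u v} → _∋_ u → _∋_ v → _∋_ (u +ᵥ v)
      close· : ∀ a {v} → _∋_ v → _∋_ (a ·ᵥ v)
  open Subspace public

  _⊆_ : Subspace → Subspace → Set
  X ⊆ Y = ∀ v → X ∋ v → Y ∋ v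

  _≐_ : Subspace → Subspace → Set
  X ≐ Y = X ⊆ Y × Y ⊆ X

  LinIndep : ∀ {d} → (Fin d → Vec) → Set
  LinIndep b = ∀ c → lincomb c b ≈ᵥ 0ᵥ → ∀ j → c j ≡ 0#

  Spans : ∀ {d} → (Fin d → Vec) → Subspace → Set
  Spans b X = ∀ v → (X ∋ v → ∃[ c ] (v ≈ᵥ lincomb c b))
                  × (∃[ c ] (v ≈ᵥ lincomb c b) → X ∋ v)

  HasDim : Subspace → ℕ → Set
  HasDim X d = Σ (Fin d → Vec) λ b → LinIndep b × Spans b X

  RightmostNZ : Vec → Fin i → Set
  RightmostNZ v j = v j ≢ 0# × (∀ k → j Fin.< k → v k ≡ 0#)

  -- j ∈ f(A(X)): j = f(L) for some line L ⊆ X, i.e. for some nonzero v ∈ X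
  InFA : Subspace → Fin i → Set
  InFA X j = ∃[ v ] (X ∋ v × ¬ (v ≈ᵥ 0ᵥ) × RightmostNZ v j)

  -- λ(X,Y) = j : the (unique) element of f(A(Y)) ∖ f(A(X))
  Label : Subspace → Subspace → Fin i → Set
  Label X Y j = InFA Y j × ¬ InFA X j

  record SegreElt : Set₁ where
    constructor ⟨_,_,_,_,_⟩
    field
      fst snd : Subspace
      rank : ℕ
      dimFst : HasDim fst rank
      dimSnd : HasDim snd rank
  open SegreElt public

  _≤S_ : SegreElt → SegreElt → Set
  x ≤S y = fst x ⊆ fst y × snd x ⊆ snd y

  _≈S_ : SegreElt → SegreElt → Set
  x ≈S y = x ≤S y × y ≤S x

  _<S_ : SegreElt → SegreElt → Set
  x <S y = x ≤S y × ¬ (y ≤S x)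

  _⋖S_ : SegreElt → SegreElt → Set₁
  x ⋖S y = x <S y × ¬ (∃[ z ] (x <S z × z <S y))

  IsMin IsMax : SegreElt → Set₁
  IsMin x = ∀ z → x ≤S z
  IsMax x = ∀ z → z ≤S x

  LabelS : SegreElt → SegreElt → Fin i × Fin i → Set
  LabelS x y (a , b) = Label (fst x) (fst y) a × Label (snd x) (snd y) b

  _<P_ : Fin i × Fin i → Fin i × Fin i → Set
  (a , b) <P (c , d) = (a Fin.≤ c × b Fin.≤ d) × ¬ ((a , b) ≡ (c , d))

  -- a maximal chain x₀ ⋖ x₁ ⋖ ⋯ ⋖ xᵢ from the minimum to the maximum
  -- (the poset is graded of rank i); only the values at 0..i matter
  record MaxChain : Set₁ where
    field
      elt    : ℕ → SegreElt
      bottom : IsMin (elt 0)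
      top    : IsMax (elt i)
      covers : ∀ k → suc k ℕ.≤ i → elt k ⋖S elt (suc k)
  open MaxChain public

  Descending : MaxChain → Set
  Descending c = ∀ k → suc (suc k) ℕ.≤ i → ∀ a b →
    LabelS (elt c k) (elt c (suc k)) a →
    LabelS (elt c (suc k)) (elt c (suc (suc k))) b →
    ¬ (a <P b)

  DescChains : Setoid (lsuc 0ℓ) 0ℓ
  DescChains = record
    { Carrier = Σ MaxChain Descending
    ; _≈_ = λ c d → ∀ k → k ℕ.≤ i → elt (proj₁ c) k ≈S elt (proj₁ d) k
    ; isEquivalence = record
      { refl  = λ k _ → ((λ v z → z) , (λ v z → z)) , ((λ v z → z) , (λ v z → z))
      ; sym   = λ p k h → proj₂ (p k h) , proj₁ (p k h)
      ; trans = λ p r k h →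
          let ((a1 , a2) , (a3 , a4)) = p k h
              ((b1 , b2) , (b3 , b4)) = r k h
          in ((λ v z → b1 v (a1 v z)) , (λ v z → b2 v (a2 v z)))
           , ((λ v z → a3 v (b3 v z)) , (λ v z → a4 v (b4 v z)))
      }
    }

NumDescChains : ∀ {q} → FiniteField q → ℕ → ℕ → Set₁
NumDescChains 𝔽 i w = Inverse (Lin.DescChains 𝔽 i) (Relation.Binary.PropositionalEquality.setoid (Fin w))
  where import Relation.Binary.PropositionalEquality

qint : ℕ → ℕ → ℕ
qint q k = foldr ℕ._+_ 0 (map (q ℕ.^_) (upTo k))

qfact : ℕ → ℕ → ℕ
qfact q zero    = 1
qfact q (suc k) = qint q (suc k) ℕ.* qfact q k

qfact-nonzero : ∀ q k → NonZero (qfact q k)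
qfact-nonzero q zero = _
qfact-nonzero q (suc k) = m*n≢0 (qint q (suc k)) (qfact q k) {{_}} {{qfact-nonzero q k}}

denom-nonzero : ∀ q n i → NonZero (qfact q i ℕ.* qfact q (n ∸ i))
denom-nonzero q n i = m*n≢0 _ _ {{qfact-nonzero q i}} {{qfact-nonzero q (n ∸ i)}}

qbinom : ℕ → ℕ → ℕ → ℕ
qbinom q n i = ℕ._/_ (qfact q n) (qfact q i ℕ.* qfact q (n ∸ i)) {{denom-nonzero q n i}}

sumℤ : ℕ → (ℕ → ℤ) → ℤ
sumℤ n f = foldr ℤ._+_ (+ 0) (map f (upTo (suc n)))

{-# OPTIONS --safe #-}

-- A subspace of codimension m is the kernel of a unique normalised linear map 𝔽ⁱ → 𝔽ᵐ, and a cover above it is a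
-- line in 𝔽ᵐ, i.e. a vector with last nonzero entry 1 in some position c < m and arbitrary entries before it.
-- The new label is the c-th unused one, so a maximal chain of Bᵢ(q) is a Lehmer code c₁, …, cᵢ together with a point
-- of a set of size q^(c₁ + ⋯ + cᵢ), and a label ascends iff cₖ ≤ cₖ₊₁. Let N(m, a, b) count the ways to continue a
-- descending chain with m labels left and last codes a, b; then Wₘ = N(m, m, m). Splitting off the continuations
-- that ascend and iterating gives
--   (-1)ᵐ N(m, a, b) = Σₖ q^((a + b) k) [m - a, k]_q [m - b, k]_q (-1)ᵐ⁻ᵏ Wₘ₋ₖ,
-- the sums over c ≥ a and d ≥ b being q-hockey-stick sums. For a = b = 0 every step ascends, so the left side is 0.

module Submission where

open import Defs
open import Level using (0ℓ)
open import Algebra.Bundles using (CommutativeRing)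
import Algebra.Properties.CommutativeSemigroup as CommutativeSemigroupProperties
import Algebra.Properties.Group as GroupProperties
import Algebra.Properties.Ring as RingProperties
open import Data.Bool using (Bool; true; false; not; _∧_; T)
open import Data.Bool.Properties using (T-irrelevant)
open import Data.Fin as Fin using (Fin; toℕ; punchIn)
import Data.Fin.Permutation as Perm
import Data.Fin.Properties as Finₚ
open import Data.Integer as ℤ using (ℤ; +_; -1ℤ)
import Data.Integer.Properties as ℤₚ
import Data.Integer.Tactic.RingSolver as ℤ-Solver
open import Data.List using (map; foldr; applyUpTo)
open import Data.Nat as ℕ using (ℕ; zero; suc; _∸_; _≤_; z≤n; s≤s; _<ᵇ_; _^_)
import Data.Nat.DivMod as ℕₚ
import Data.Nat.Properties as ℕₚ
import Data.Nat.Tactic.RingSolver as ℕ-Solver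
open import Data.Product using (Σ; ∃; _×_; _,_; proj₁; proj₂)
open import Data.Product.Function.NonDependent.Propositional using (_×-↔_)
open import Data.Sum using (_⊎_; inj₁; inj₂)
open import Data.Sum.Function.Propositional using (_⊎-↔_)
open import Data.Unit using (⊤; tt)
open import Function using (_∘_; id)
open import Function.Bundles using (_↔_; Injection; Inverse; mk↔ₛ′)
open import Function.Properties.Inverse using (↔-trans; ↔-sym; ↔⇒↣)
open import Relation.Binary.Bundles using (Setoid)
open import Relation.Binary.Definitions using (DecidableEquality; tri<; tri≈; tri>)
open import Relation.Binary.PropositionalEquality using (_≡_; _≢_; refl; sym; trans; cong; cong₂; subst; module ≡-Reasoning)
open import Relation.Nullary using (¬_; Dec; yes; no; contradiction)
open import Relation.Nullary.Decidable using (map′; ¬?; via-injection)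
open import Algebra.Properties.Semiring.Sum ℕₚ.+-*-semiring as ΣN using () renaming (sum to ∑)
open import Algebra.Properties.Semiring.Sum ℤₚ.+-*-semiring as Σℤ using () renaming (sum to ∑ℤ)

-- Finite sums of integers

+-∑ : ∀ {n} (f : Fin n → ℕ) → + ∑ f ≡ ∑ℤ (λ c → + f c)
+-∑ {zero}  f = refl
+-∑ {suc n} f = trans (ℤₚ.pos-+ (f Fin.zero) _) (cong (λ x → + f Fin.zero ℤ.+ x) (+-∑ (f ∘ Fin.suc)))

∑ℤ-product : ∀ {m n} (f : Fin m → ℤ) (g : Fin n → ℤ) v →
  ∑ℤ (λ c → ∑ℤ (λ d → f c ℤ.* g d ℤ.* v)) ≡ ∑ℤ f ℤ.* ∑ℤ g ℤ.* v
∑ℤ-product f g v = begin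
  ∑ℤ (λ c → ∑ℤ (λ d → f c ℤ.* g d ℤ.* v))
    ≡⟨ Σℤ.sum-cong-≗ (λ c → sym (Σℤ.*-distribʳ-sum v (λ d → f c ℤ.* g d))) ⟩
  ∑ℤ (λ c → ∑ℤ (λ d → f c ℤ.* g d) ℤ.* v)
    ≡⟨ sym (Σℤ.*-distribʳ-sum v (λ c → ∑ℤ (λ d → f c ℤ.* g d))) ⟩
  ∑ℤ (λ c → ∑ℤ (λ d → f c ℤ.* g d)) ℤ.* v
    ≡⟨ cong (ℤ._* v) (Σℤ.sum-cong-≗ (λ c → sym (Σℤ.*-distribˡ-sum (f c) g))) ⟩
  ∑ℤ (λ c → f c ℤ.* ∑ℤ g) ℤ.* v
    ≡⟨ cong (ℤ._* v) (sym (Σℤ.*-distribʳ-sum (∑ℤ g) f)) ⟩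
  ∑ℤ f ℤ.* ∑ℤ g ℤ.* v ∎
  where open ≡-Reasoning

sumℤ-∑ℤ : ∀ n f → sumℤ n f ≡ ∑ℤ {suc n} (f ∘ toℕ)
sumℤ-∑ℤ n f = go (suc n) id
  where
  -- The index function varies because unfolding `applyUpTo g` continues with `g ∘ suc`.
  go : ∀ k (g : ℕ → ℕ) → foldr ℤ._+_ (+ 0) (map f (applyUpTo g k)) ≡ ∑ℤ {k} (λ c → f (g (toℕ c)))
  go zero    g = refl
  go (suc k) g = cong (λ x → f (g 0) ℤ.+ x) (go k (g ∘ suc))

-- Weighted count of descending codes and its q-binomial expansion

bit : Bool → ℕ
bit true  = 1
bit false = 0

-- In this form `0 ≤ᵗ c` and `suc a ≤ᵗ suc c` reduce for variable `a` and `c`, as `hockey-stick` and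
-- `count-zero` need.
_≤ᵗ_ : ℕ → ℕ → Bool
a ≤ᵗ c = a <ᵇ suc c

noAscent : ℕ → ℕ → ℕ → ℕ → Bool
noAscent a b c d = not ((a ≤ᵗ c) ∧ (b ≤ᵗ d))

ascent : ℕ → ℕ → ℕ → ℕ → ℕ
ascent a b c d = bit (a ≤ᵗ c) ℕ.* bit (b ≤ᵗ d)

module Count (q : ℕ) where

  -- A line with pivot in position `c` has `c` free entries, so `q ^ c ℕ.* q ^ d` pairs of lines
  -- realise the ranks `c` and `d`.
  weight : (m : ℕ) → (ℕ → ℕ → ℕ) → Fin m → Fin m → ℕ
  weight m f c d = (q ^ toℕ c ℕ.* q ^ toℕ d) ℕ.* f (toℕ c) (toℕ d)

  count : ℕ → ℕ → ℕ → ℕ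
  count zero    a b = 1
  count (suc m) a b = ∑ λ c → ∑ λ d → bit (noAscent a b (toℕ c) (toℕ d)) ℕ.* weight (suc m) (count m) c d

  total : ℕ → ℕ
  total zero    = 1
  total (suc m) = ∑ λ c → ∑ λ d → weight (suc m) (count m) c d

  -- No rank c < m satisfies m ≤ c, so the previous ranks a = b = m impose no condition on the first step.
  count-total : ∀ m → count m m m ≡ total m
  count-total zero = refl
  count-total (suc m) = ΣN.sum-cong-≗ λ c → ΣN.sum-cong-≗ λ d →
    trans (cong (λ x → bit (not (x ∧ (suc m ≤ᵗ toℕ d))) ℕ.* weight (suc m) (count m) c d) (big c))
          (ℕₚ.+-identityʳ _)
    where
    big : ∀ (c : Fin (suc m)) → (suc m ≤ᵗ toℕ c) ≡ false
    big c with suc m ≤ᵗ toℕ c in eq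
    ... | false = refl
    ... | true  = contradiction (Finₚ.toℕ<n c) (ℕₚ.<⇒≱ (ℕₚ.<ᵇ⇒< (suc m) (suc (toℕ c)) (subst T (sym eq) tt)))

  -- The q-binomial coefficient without division. Of the two q-Pascal rules this is the one produced
  -- by splitting off `c = 0` in `hockey-stick`.
  gauss : ℕ → ℕ → ℕ
  gauss n       zero    = 1
  gauss zero    (suc k) = 0
  gauss (suc n) (suc k) = gauss n k ℕ.+ q ^ suc k ℕ.* gauss n (suc k)

  hook : ℕ → ℕ → ℕ → ℕ → ℕ
  hook m k a c = bit (a ≤ᵗ c) ℕ.* (q ^ (c ℕ.* suc k) ℕ.* gauss (m ∸ suc c) k)

  -- The terms with `c > 0` form the same sum for `m - 1`, multiplied by `q ^ suc k`; this is
  -- `shifted`. For `a = 0` the term `c = 0` completes it to the recursion of `gauss`; for `a > 0`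
  -- that term vanishes, and `a` drops by one along with `m`.
  hockey-stick : ∀ m k a → ∑ {m} (hook m k a ∘ toℕ) ≡ q ^ (a ℕ.* suc k) ℕ.* gauss (m ∸ a) (suc k)
  shifted : ∀ m k a → ∑ {m} (λ c → bit (a ≤ᵗ toℕ c) ℕ.* (q ^ (suc (toℕ c) ℕ.* suc k) ℕ.* gauss (m ∸ suc (toℕ c)) k))
    ≡ q ^ suc k ℕ.* (q ^ (a ℕ.* suc k) ℕ.* gauss (m ∸ a) (suc k))

  shifted m k a = begin
    _ ≡⟨ ΣN.sum-cong-≗ {m} (λ c → lemma (bit (a ≤ᵗ toℕ c)) (toℕ c) (gauss (m ∸ suc (toℕ c)) k)) ⟩
    ∑ {m} (λ c → q ^ suc k ℕ.* hook m k a (toℕ c)) ≡⟨ sym (ΣN.*-distribˡ-sum {m} (q ^ suc k) (hook m k a ∘ toℕ)) ⟩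
    q ^ suc k ℕ.* ∑ {m} (hook m k a ∘ toℕ)         ≡⟨ cong (q ^ suc k ℕ.*_) (hockey-stick m k a) ⟩
    _ ∎
    where
    open ≡-Reasoning
    swap : ∀ x y z g → x ℕ.* ((y ℕ.* z) ℕ.* g) ≡ y ℕ.* (x ℕ.* (z ℕ.* g))
    swap = ℕ-Solver.solve-∀
    lemma : ∀ x c g → x ℕ.* (q ^ (suc c ℕ.* suc k) ℕ.* g) ≡ q ^ suc k ℕ.* (x ℕ.* (q ^ (c ℕ.* suc k) ℕ.* g))
    lemma x c g = trans (cong (λ y → x ℕ.* (y ℕ.* g)) (ℕₚ.^-distribˡ-+-* q (suc k) (c ℕ.* suc k)))
      (swap x (q ^ suc k) (q ^ (c ℕ.* suc k)) g)

  hockey-stick zero    k a rewrite ℕₚ.0∸n≡0 a = sym (ℕₚ.*-zeroʳ (q ^ (a ℕ.* suc k)))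
  hockey-stick (suc m) k zero = begin
    _ ≡⟨ cong₂ ℕ._+_ (trans (ℕₚ.+-identityʳ _) (ℕₚ.+-identityʳ _)) (shifted m k zero) ⟩
    gauss m k ℕ.+ q ^ suc k ℕ.* (1 ℕ.* gauss m (suc k)) ≡⟨ cong (λ x → gauss m k ℕ.+ q ^ suc k ℕ.* x) (ℕₚ.*-identityˡ _) ⟩
    gauss (suc m) (suc k) ≡⟨ sym (ℕₚ.*-identityˡ _) ⟩
    _ ∎
    where open ≡-Reasoning
  hockey-stick (suc m) k (suc a) = begin
    _ ≡⟨ shifted m k a ⟩
    q ^ suc k ℕ.* (q ^ (a ℕ.* suc k) ℕ.* gauss (m ∸ a) (suc k)) ≡⟨ sym (ℕₚ.*-assoc (q ^ suc k) _ _) ⟩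
    (q ^ suc k ℕ.* q ^ (a ℕ.* suc k)) ℕ.* gauss (m ∸ a) (suc k)
      ≡⟨ cong (ℕ._* gauss (m ∸ a) (suc k)) (sym (ℕₚ.^-distribˡ-+-* q (suc k) (a ℕ.* suc k))) ⟩
    _ ∎
    where open ≡-Reasoning

  signedTotal : ℕ → ℤ
  signedTotal m = (-1ℤ ℤ.^ m) ℤ.* + total m

  signedCount : ℕ → ℕ → ℕ → ℤ
  signedCount m a b = (-1ℤ ℤ.^ m) ℤ.* + count m a b

  ascentWeight : ℕ → ℕ → ℕ → ℕ → ℕ
  ascentWeight a b c d = ascent a b c d ℕ.* (q ^ c ℕ.* q ^ d)

  -- Each step either ascends or does not; the additive form avoids subtraction in ℕ.
  count-complement : ∀ m a b →
    count (suc m) a b ℕ.+ ∑ (λ c → ∑ λ d → ascent a b (toℕ c) (toℕ d) ℕ.* weight (suc m) (count m) c d) ≡ total (suc m)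
  count-complement m a b = trans (sym (ΣN.∑-distrib-+ (λ c → ∑ (f c)) (λ c → ∑ (g c))))
    (ΣN.sum-cong-≗ λ c → trans (sym (ΣN.∑-distrib-+ (f c) (g c)))
      (ΣN.sum-cong-≗ λ d → split (a ≤ᵗ toℕ c) (b ≤ᵗ toℕ d) (weight (suc m) (count m) c d)))
    where
    f g : Fin (suc m) → Fin (suc m) → ℕ
    f c d = bit (noAscent a b (toℕ c) (toℕ d)) ℕ.* weight (suc m) (count m) c d
    g c d = ascent a b (toℕ c) (toℕ d) ℕ.* weight (suc m) (count m) c d
    split : ∀ x y g → bit (not (x ∧ y)) ℕ.* g ℕ.+ (bit x ℕ.* bit y) ℕ.* g ≡ g
    split true  true  g = ℕₚ.+-identityʳ g
    split true  false g = trans (ℕₚ.+-identityʳ _) (ℕₚ.+-identityʳ g)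
    split false true  g = trans (ℕₚ.+-identityʳ _) (ℕₚ.+-identityʳ g)
    split false false g = trans (ℕₚ.+-identityʳ _) (ℕₚ.+-identityʳ g)

  -- The ascending continuations are subtracted from the total, but they carry the sign of `m`
  -- instead of `suc m`, so the recursion has a plus.
  signedCount-suc : ∀ m a b → signedCount (suc m) a b ≡
    signedTotal (suc m) ℤ.+ ∑ℤ {suc m} (λ c → ∑ℤ {suc m} λ d →
      + ascentWeight a b (toℕ c) (toℕ d) ℤ.* signedCount m (toℕ c) (toℕ d))
  signedCount-suc m a b = begin
    s' ℤ.* + count (suc m) a b
      ≡⟨ step s (+ count (suc m) a b) (+ R) ⟩
    s' ℤ.* (+ count (suc m) a b ℤ.+ + R) ℤ.+ s ℤ.* + R
      ≡⟨ cong₂ (λ x y → s' ℤ.* x ℤ.+ y) (trans (sym (ℤₚ.pos-+ (count (suc m) a b) R)) (cong +_ (count-complement m a b))) sR ⟩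
    signedTotal (suc m) ℤ.+ _ ∎
    where
    open ≡-Reasoning
    s s' : ℤ
    s  = -1ℤ ℤ.^ m
    s' = -1ℤ ℤ.^ suc m
    g : Fin (suc m) → Fin (suc m) → ℕ
    g c d = ascent a b (toℕ c) (toℕ d) ℕ.* weight (suc m) (count m) c d
    R : ℕ
    R = ∑ (λ c → ∑ (g c))
    step : ∀ s x y → (-1ℤ ℤ.* s) ℤ.* x ≡ (-1ℤ ℤ.* s) ℤ.* (x ℤ.+ y) ℤ.+ s ℤ.* y
    step = ℤ-Solver.solve-∀
    move : ∀ s x y → s ℤ.* (x ℤ.* y) ≡ x ℤ.* (s ℤ.* y)
    move = ℤ-Solver.solve-∀
    term : ∀ c d → s ℤ.* + g c d ≡ + ascentWeight a b (toℕ c) (toℕ d) ℤ.* signedCount m (toℕ c) (toℕ d)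
    term c d = trans
      (cong (λ x → s ℤ.* + x)
        (sym (ℕₚ.*-assoc (ascent a b (toℕ c) (toℕ d)) (q ^ toℕ c ℕ.* q ^ toℕ d) (count m (toℕ c) (toℕ d)))))
      (trans (cong (s ℤ.*_) (ℤₚ.pos-* (ascentWeight a b (toℕ c) (toℕ d)) (count m (toℕ c) (toℕ d))))
       (move s (+ ascentWeight a b (toℕ c) (toℕ d)) (+ count m (toℕ c) (toℕ d))))
    sR : s ℤ.* + R ≡ ∑ℤ {suc m} (λ c → ∑ℤ {suc m} λ d →
      + ascentWeight a b (toℕ c) (toℕ d) ℤ.* signedCount m (toℕ c) (toℕ d))
    sR = begin
      s ℤ.* + R ≡⟨ cong (s ℤ.*_) (+-∑ (λ c → ∑ (g c))) ⟩
      s ℤ.* ∑ℤ (λ c → + ∑ (g c)) ≡⟨ Σℤ.*-distribˡ-sum s (λ c → + ∑ (g c)) ⟩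
      ∑ℤ (λ c → s ℤ.* + ∑ (g c)) ≡⟨ Σℤ.sum-cong-≗ (λ c → trans (cong (s ℤ.*_) (+-∑ (g c)))
             (trans (Σℤ.*-distribˡ-sum s (λ d → + g c d)) (Σℤ.sum-cong-≗ (term c)))) ⟩
      _ ∎

  coefficient : ℕ → ℕ → ℕ → ℕ
  coefficient m a k = q ^ (a ℕ.* k) ℕ.* gauss (m ∸ a) k

  -- Induction on `m` through `signedCount-suc`: the total is the term `k = 0`, and term `k` of the
  -- inner expansions, summed over `c` and `d`, becomes term `k + 1`. For `a ≥ m` the truncated
  -- `m ∸ a` is 0 and only `k = 0` contributes.
  signedCount-expansion : ∀ m a b → signedCount m a b ≡
    ∑ℤ {suc m} (λ k → + coefficient m a (toℕ k) ℤ.* + coefficient m b (toℕ k) ℤ.* signedTotal (m ∸ toℕ k))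
  signedCount-expansion zero a b rewrite ℕₚ.*-zeroʳ a | ℕₚ.*-zeroʳ b = refl
  signedCount-expansion (suc m) a b = begin
    signedCount (suc m) a b ≡⟨ signedCount-suc m a b ⟩
    signedTotal (suc m) ℤ.+ ∑ℤ {suc m} (λ c → ∑ℤ {suc m} λ d →
      + ascentWeight a b (toℕ c) (toℕ d) ℤ.* signedCount m (toℕ c) (toℕ d))
      ≡⟨ cong (λ x → signedTotal (suc m) ℤ.+ x) rest ⟩
    signedTotal (suc m) ℤ.+ ∑ℤ {suc m} (tail ∘ toℕ)
      ≡⟨ cong (ℤ._+ ∑ℤ {suc m} (tail ∘ toℕ)) first ⟩
    _ ∎
    where
    open ≡-Reasoning
    first : signedTotal (suc m) ≡ + (q ^ (a ℕ.* 0) ℕ.* 1) ℤ.* + (q ^ (b ℕ.* 0) ℕ.* 1) ℤ.* signedTotal (suc m)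
    first rewrite ℕₚ.*-zeroʳ a | ℕₚ.*-zeroʳ b = sym (ℤₚ.*-identityˡ (signedTotal (suc m)))
    tail : ℕ → ℤ
    tail k = + coefficient (suc m) a (suc k) ℤ.* + coefficient (suc m) b (suc k) ℤ.* signedTotal (m ∸ k)
    h : ℕ → ℕ → ℕ → ℤ
    h k a c = + hook (suc m) k a c
    regroup : ∀ x y Qc Qd Pc Pd g g' → (x ℕ.* y ℕ.* (Qc ℕ.* Qd)) ℕ.* ((Pc ℕ.* g) ℕ.* (Pd ℕ.* g'))
      ≡ (x ℕ.* ((Qc ℕ.* Pc) ℕ.* g)) ℕ.* (y ℕ.* ((Qd ℕ.* Pd) ℕ.* g'))
    regroup = ℕ-Solver.solve-∀
    qpow : ∀ c k → q ^ c ℕ.* q ^ (c ℕ.* k) ≡ q ^ (c ℕ.* suc k)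
    qpow c k = trans (sym (ℕₚ.^-distribˡ-+-* q c (c ℕ.* k))) (cong (q ^_) (sym (ℕₚ.*-suc c k)))
    -- The weight `q ^ c` of the step raises the exponent `c k` to `c (k + 1)`, and `m ∸ c` is
    -- `suc m ∸ suc c`, which gives the shape of `hook`.
    termℕ : ∀ c d k → ascentWeight a b c d ℕ.* (coefficient m c k ℕ.* coefficient m d k)
      ≡ hook (suc m) k a c ℕ.* hook (suc m) k b d
    termℕ c d k = trans
      (regroup (bit (a ≤ᵗ c)) (bit (b ≤ᵗ d)) (q ^ c) (q ^ d) (q ^ (c ℕ.* k)) (q ^ (d ℕ.* k)) (gauss (m ∸ c) k) (gauss (m ∸ d) k))
      (cong₂ (λ x y → (bit (a ≤ᵗ c) ℕ.* (x ℕ.* gauss (m ∸ c) k)) ℕ.* (bit (b ≤ᵗ d) ℕ.* (y ℕ.* gauss (m ∸ d) k)))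
        (qpow c k) (qpow d k))
    term : ∀ c d k → + ascentWeight a b c d ℤ.* (+ coefficient m c k ℤ.* + coefficient m d k ℤ.* signedTotal (m ∸ k))
      ≡ h k a c ℤ.* h k b d ℤ.* signedTotal (m ∸ k)
    term c d k = begin
      + x ℤ.* (+ y ℤ.* + z ℤ.* v) ≡⟨ sym (ℤₚ.*-assoc (+ x) (+ y ℤ.* + z) v) ⟩
      + x ℤ.* (+ y ℤ.* + z) ℤ.* v ≡⟨ cong (λ t → + x ℤ.* t ℤ.* v) (sym (ℤₚ.pos-* y z)) ⟩
      + x ℤ.* + (y ℕ.* z) ℤ.* v   ≡⟨ cong (ℤ._* v) (sym (ℤₚ.pos-* x (y ℕ.* z))) ⟩
      + (x ℕ.* (y ℕ.* z)) ℤ.* v   ≡⟨ cong (λ t → + t ℤ.* v) (termℕ c d k) ⟩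
      + (hook (suc m) k a c ℕ.* hook (suc m) k b d) ℤ.* v
        ≡⟨ cong (ℤ._* v) (ℤₚ.pos-* (hook (suc m) k a c) (hook (suc m) k b d)) ⟩
      h k a c ℤ.* h k b d ℤ.* v ∎
      where
      x = ascentWeight a b c d
      y = coefficient m c k
      z = coefficient m d k
      v = signedTotal (m ∸ k)
    coef : Fin (suc m) → Fin (suc m) → ℤ
    coef c d = + ascentWeight a b (toℕ c) (toℕ d)
    F : Fin (suc m) → Fin (suc m) → Fin (suc m) → ℤ
    F c d k = h (toℕ k) a (toℕ c) ℤ.* h (toℕ k) b (toℕ d) ℤ.* signedTotal (m ∸ toℕ k)
    hockeyℤ : ∀ k a → ∑ℤ {suc m} (λ c → h k a (toℕ c)) ≡ + coefficient (suc m) a (suc k)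
    hockeyℤ k a = trans (sym (+-∑ {suc m} (hook (suc m) k a ∘ toℕ))) (cong +_ (hockey-stick (suc m) k a))
    rest : ∑ℤ {suc m} (λ c → ∑ℤ {suc m} λ d →
      + ascentWeight a b (toℕ c) (toℕ d) ℤ.* signedCount m (toℕ c) (toℕ d)) ≡ ∑ℤ {suc m} (tail ∘ toℕ)
    rest = begin
      _ ≡⟨ Σℤ.sum-cong-≗ {suc m} (λ c → Σℤ.sum-cong-≗ {suc m} λ d → trans
             (cong (λ x → + ascentWeight a b (toℕ c) (toℕ d) ℤ.* x) (signedCount-expansion m (toℕ c) (toℕ d)))
             (trans (Σℤ.*-distribˡ-sum {suc m} (coef c d) 
               (λ k → + coefficient m (toℕ c) (toℕ k) ℤ.* + coefficient m (toℕ d) (toℕ k) ℤ.* signedTotal (m ∸ toℕ k)))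
               (Σℤ.sum-cong-≗ {suc m} λ k → term (toℕ c) (toℕ d) (toℕ k)))) ⟩
      -- With `k` outermost, each double sum over `c` and `d` factors into two hockey-stick sums.
      ∑ℤ (λ c → ∑ℤ λ d → ∑ℤ λ k → F c d k) ≡⟨ Σℤ.sum-cong-≗ (λ c → Σℤ.∑-comm (F c)) ⟩
      ∑ℤ (λ c → ∑ℤ λ k → ∑ℤ λ d → F c d k) ≡⟨ Σℤ.∑-comm (λ c k → ∑ℤ λ d → F c d k) ⟩
      ∑ℤ (λ k → ∑ℤ λ c → ∑ℤ λ d → F c d k) ≡⟨ Σℤ.sum-cong-≗ {suc m} (λ k → trans
            (∑ℤ-product {suc m} {suc m} (λ c → h (toℕ k) a (toℕ c)) (λ d → h (toℕ k) b (toℕ d)) (signedTotal (m ∸ toℕ k)))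
            (cong₂ (λ x y → x ℤ.* y ℤ.* signedTotal (m ∸ toℕ k)) (hockeyℤ (toℕ k) a) (hockeyℤ (toℕ k) b))) ⟩
      _ ∎

  -- Every step ascends from ranks 0 and 0, so every indicator computes to 0. At least one step must
  -- remain, since `count zero` is 1; here `1 ≤ n` enters.
  count-zero : ∀ m → count (suc m) 0 0 ≡ 0
  count-zero m = trans (ΣN.sum-cong-≗ {suc m} (λ _ → ΣN.sum-replicate-zero (suc m))) (ΣN.sum-replicate-zero (suc m))

  -- q-factorials and the quotient form of the q-binomial

  qint-+ : ∀ k l → qint q (k ℕ.+ l) ≡ qint q k ℕ.+ q ^ k ℕ.* qint q l
  qint-+ k l = trans (eq (k ℕ.+ l)) (trans (go k l) (cong₂ (λ x y → x ℕ.+ q ^ k ℕ.* y) (sym (eq k)) (sym (eq l))))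
    where
    sm : (ℕ → ℕ) → ℕ → ℕ
    sm g k = foldr ℕ._+_ 0 (map (q ^_) (applyUpTo g k))
    -- The Horner form of the q-integer, for which the addition rule is an induction on `k`.
    qi : ℕ → ℕ
    qi zero    = 0
    qi (suc k) = 1 ℕ.+ q ℕ.* qi k
    shift : ∀ k g g' → (∀ n → g n ≡ suc (g' n)) → sm g k ≡ q ℕ.* sm g' k
    shift zero    g g' p = sym (ℕₚ.*-zeroʳ q)
    shift (suc k) g g' p = trans (cong₂ ℕ._+_ (cong (q ^_) (p 0)) (shift k (g ∘ suc) (g' ∘ suc) (p ∘ suc)))
      (sym (ℕₚ.*-distribˡ-+ q (q ^ g' 0) _))
    eq : ∀ k → qint q k ≡ qi k
    eq zero    = refl
    eq (suc k) = cong suc (trans (shift k suc id (λ _ → refl)) (cong (q ℕ.*_) (eq k)))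
    alg : ∀ q x p y → 1 ℕ.+ q ℕ.* (x ℕ.+ p ℕ.* y) ≡ (1 ℕ.+ q ℕ.* x) ℕ.+ q ℕ.* p ℕ.* y
    alg = ℕ-Solver.solve-∀
    go : ∀ k l → qi (k ℕ.+ l) ≡ qi k ℕ.+ q ^ k ℕ.* qi l
    go zero    l = sym (ℕₚ.+-identityʳ (qi l))
    go (suc k) l = trans (cong (λ x → 1 ℕ.+ q ℕ.* x) (go k l)) (alg q (qi k) (q ^ k) (qi l))

  gauss-above : ∀ n k → gauss n (suc (n ℕ.+ k)) ≡ 0
  gauss-above zero    k = refl
  gauss-above (suc n) k = trans (cong₂ (λ x y → x ℕ.+ q ^ suc (suc (n ℕ.+ k)) ℕ.* y) (gauss-above n k)
      (trans (cong (λ x → gauss n (suc x)) (sym (ℕₚ.+-suc n k))) (gauss-above n (suc k)))) (ℕₚ.*-zeroʳ (q ^ suc (suc (n ℕ.+ k))))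

  -- The two terms of the q-Pascal rule contribute the factors `qint q (suc k)` and
  -- `q ^ suc k ℕ.* qint q l`, whose sum is the q-integer of `suc k ℕ.+ l` by `qint-+`.
  gauss-qfact : ∀ k l → gauss (k ℕ.+ l) k ℕ.* (qfact q k ℕ.* qfact q l) ≡ qfact q (k ℕ.+ l)
  gauss-qfact zero    l = trans (ℕₚ.+-identityʳ _) (ℕₚ.+-identityʳ _)
  gauss-qfact (suc k) l = begin
    (gauss (k ℕ.+ l) k ℕ.+ p ℕ.* gauss (k ℕ.+ l) (suc k)) ℕ.* ((qint q (suc k) ℕ.* qfact q k) ℕ.* qfact q l)
      ≡⟨ alg (gauss (k ℕ.+ l) k) p (gauss (k ℕ.+ l) (suc k)) (qint q (suc k)) (qfact q k) (qfact q l) ⟩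
    qint q (suc k) ℕ.* (gauss (k ℕ.+ l) k ℕ.* (qfact q k ℕ.* qfact q l)) ℕ.+
    p ℕ.* (gauss (k ℕ.+ l) (suc k) ℕ.* (qfact q (suc k) ℕ.* qfact q l))
      ≡⟨ cong₂ (λ x y → qint q (suc k) ℕ.* x ℕ.+ p ℕ.* y) (gauss-qfact k l) (second l) ⟩
    qint q (suc k) ℕ.* qfact q (k ℕ.+ l) ℕ.+ p ℕ.* (qint q l ℕ.* qfact q (k ℕ.+ l))
      ≡⟨ alg' (qint q (suc k)) (qfact q (k ℕ.+ l)) p (qint q l) ⟩
    (qint q (suc k) ℕ.+ p ℕ.* qint q l) ℕ.* qfact q (k ℕ.+ l)
      ≡⟨ cong (ℕ._* qfact q (k ℕ.+ l)) (sym (qint-+ (suc k) l)) ⟩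
    qfact q (suc k ℕ.+ l) ∎
    where
    open ≡-Reasoning
    p : ℕ
    p = q ^ suc k
    alg : ∀ g p g' x y z → (g ℕ.+ p ℕ.* g') ℕ.* ((x ℕ.* y) ℕ.* z) 
      ≡ x ℕ.* (g ℕ.* (y ℕ.* z)) ℕ.+ p ℕ.* (g' ℕ.* ((x ℕ.* y) ℕ.* z))
    alg = ℕ-Solver.solve-∀
    alg' : ∀ x f p y → x ℕ.* f ℕ.+ p ℕ.* (y ℕ.* f) ≡ (x ℕ.+ p ℕ.* y) ℕ.* f
    alg' = ℕ-Solver.solve-∀
    alg'' : ∀ g f x y → g ℕ.* (f ℕ.* (x ℕ.* y)) ≡ x ℕ.* (g ℕ.* (f ℕ.* y))
    alg'' = ℕ-Solver.solve-∀
    -- For `l = 0` both sides vanish; otherwise `k + suc l` is read as `suc k + l`, where the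
    -- induction hypothesis applies with smaller `l`.
    second : ∀ l → gauss (k ℕ.+ l) (suc k) ℕ.* (qfact q (suc k) ℕ.* qfact q l) ≡ qint q l ℕ.* qfact q (k ℕ.+ l)
    second zero = cong (ℕ._* (qfact q (suc k) ℕ.* 1))
      (trans (cong₂ gauss (ℕₚ.+-identityʳ k) (cong suc (sym (ℕₚ.+-identityʳ k)))) (gauss-above k 0))
    second (suc l) = begin
      gauss (k ℕ.+ suc l) (suc k) ℕ.* (qfact q (suc k) ℕ.* qfact q (suc l))
        ≡⟨ cong (λ x → gauss x (suc k) ℕ.* (qfact q (suc k) ℕ.* qfact q (suc l))) (ℕₚ.+-suc k l) ⟩
      gauss (suc k ℕ.+ l) (suc k) ℕ.* (qfact q (suc k) ℕ.* (qint q (suc l) ℕ.* qfact q l))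
        ≡⟨ alg'' (gauss (suc k ℕ.+ l) (suc k)) (qfact q (suc k)) (qint q (suc l)) (qfact q l) ⟩
      qint q (suc l) ℕ.* (gauss (suc k ℕ.+ l) (suc k) ℕ.* (qfact q (suc k) ℕ.* qfact q l))
        ≡⟨ cong (qint q (suc l) ℕ.*_) (gauss-qfact (suc k) l) ⟩
      qint q (suc l) ℕ.* qfact q (suc k ℕ.+ l)
        ≡⟨ cong (λ x → qint q (suc l) ℕ.* qfact q x) (sym (ℕₚ.+-suc k l)) ⟩
      _ ∎

  -- The division is exact by `gauss-qfact`. The index `n ∸ k` has the symmetry of the q-binomial
  -- built in and is the one that occurs once the sum is reversed.
  qbinom-gauss : ∀ n k → k ≤ n → qbinom q n (n ∸ k) ≡ gauss n k
  qbinom-gauss n k k≤n = begin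
    qbinom q n (n ∸ k)
      ≡⟨ ℕₚ./-congˡ {{denom-nonzero q n (n ∸ k)}} top ⟩
    ℕ._/_ (gauss n k ℕ.* denominator) denominator {{denom-nonzero q n (n ∸ k)}}
      ≡⟨ ℕₚ.m*n/n≡m (gauss n k) _ {{denom-nonzero q n (n ∸ k)}} ⟩
    gauss n k ∎
    where
    open ≡-Reasoning
    denominator : ℕ
    denominator = qfact q (n ∸ k) ℕ.* qfact q (n ∸ (n ∸ k))
    top : qfact q n ≡ gauss n k ℕ.* denominator
    top = begin
      qfact q n ≡⟨ cong (qfact q) (sym (ℕₚ.m+[n∸m]≡n k≤n)) ⟩
      qfact q (k ℕ.+ (n ∸ k)) ≡⟨ sym (gauss-qfact k (n ∸ k)) ⟩
      gauss (k ℕ.+ (n ∸ k)) k ℕ.* (qfact q k ℕ.* qfact q (n ∸ k))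
        ≡⟨ cong₂ ℕ._*_ (cong (λ x → gauss x k) (ℕₚ.m+[n∸m]≡n k≤n)) (trans (ℕₚ.*-comm (qfact q k) _)
             (cong (λ x → qfact q (n ∸ k) ℕ.* qfact q x) (sym (ℕₚ.m∸[m∸n]≡n k≤n)))) ⟩
      _ ∎

  alternating-sum : ∀ n → 1 ≤ n → (W : ℕ → ℕ) → (∀ i → W i ≡ total i) →
    sumℤ n (λ i → (+ (qbinom q n i ^ 2)) ℤ.* ((-1ℤ ℤ.^ i) ℤ.* (+ W i))) ≡ + 0
  alternating-sum (suc m) _ W W≡total = begin
    sumℤ n f ≡⟨ sumℤ-∑ℤ n f ⟩
    -- Substituting i = n - k turns the sum into the expansion of `signedCount n 0 0`.
    ∑ℤ {suc n} (f ∘ toℕ) ≡⟨ Σℤ.sum-permute (f ∘ toℕ) (Perm.reverse {suc n}) ⟩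
    ∑ℤ {suc n} (λ k → f (toℕ (Fin.opposite k))) ≡⟨ Σℤ.sum-cong-≗ term ⟩
    _ ≡⟨ sym (signedCount-expansion n 0 0) ⟩
    (-1ℤ ℤ.^ n) ℤ.* + count n 0 0 ≡⟨ cong (λ x → (-1ℤ ℤ.^ n) ℤ.* + x) (count-zero m) ⟩
    (-1ℤ ℤ.^ n) ℤ.* + 0 ≡⟨ ℤₚ.*-zeroʳ (-1ℤ ℤ.^ n) ⟩
    + 0 ∎
    where
    open ≡-Reasoning
    n = suc m
    f : ℕ → ℤ
    f i = (+ (qbinom q n i ^ 2)) ℤ.* ((-1ℤ ℤ.^ i) ℤ.* (+ W i))
    term : ∀ (k : Fin (suc n)) → f (toℕ (Fin.opposite k)) ≡
      + coefficient n 0 (toℕ k) ℤ.* + coefficient n 0 (toℕ k) ℤ.* signedTotal (n ∸ toℕ k)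
    term k = begin
      f (toℕ (Fin.opposite k)) ≡⟨ cong f (Finₚ.opposite-prop k) ⟩
      f (n ∸ toℕ k) ≡⟨ cong₂ (λ x y → + (x ^ 2) ℤ.* ((-1ℤ ℤ.^ (n ∸ toℕ k)) ℤ.* + y))
             (qbinom-gauss n (toℕ k) (ℕₚ.≤-pred (Finₚ.toℕ<n k))) (W≡total (n ∸ toℕ k)) ⟩
      + (g ℕ.* (g ℕ.* 1)) ℤ.* signedTotal (n ∸ toℕ k) ≡⟨ cong (ℤ._* signedTotal (n ∸ toℕ k)) (trans (ℤₚ.pos-* g (g ℕ.* 1))
             (cong₂ (λ x y → + x ℤ.* + y) (sym (ℕₚ.*-identityˡ g)) (ℕₚ.*-comm g 1))) ⟩
      _ ∎
      where g = gauss n (toℕ k)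

-- Codes as finite sets

module Codes (q : ℕ) where
  open Count q

  -- A step consists of the ranks c and d of the new labels among the m + 1 unused ones, and of the free entries of the
  -- two vectors spanning the new lines; a and b are the ranks chosen in the previous step.
  Code : ℕ → ℕ → ℕ → Set
  Code zero    a b = ⊤
  Code (suc m) a b = Σ (Fin (suc m)) λ c → Σ (Fin (suc m)) λ d →
    T (noAscent a b (toℕ c) (toℕ d)) ×
    ((Fin (q ℕ.^ toℕ c) × Fin (q ℕ.^ toℕ d)) × Code m (toℕ c) (toℕ d))

  Fin-∑ : ∀ {n} (f : Fin n → ℕ) {B : Fin n → Set} → (∀ c → Fin (f c) ↔ B c) → Fin (∑ f) ↔ Σ (Fin n) B
  Fin-∑ {zero}  f e = mk↔ₛ′ (λ ()) (λ { (() , _) }) (λ { (() , _) }) (λ ())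
  Fin-∑ {suc n} f {B} e = ↔-trans (Finₚ.+↔⊎ {f Fin.zero})
    (↔-trans (e Fin.zero ⊎-↔ Fin-∑ (f ∘ Fin.suc) (e ∘ Fin.suc)) split)
    where
    split : (B Fin.zero ⊎ Σ (Fin n) (B ∘ Fin.suc)) ↔ Σ (Fin (suc n)) B
    split = mk↔ₛ′ (λ { (inj₁ b) → Fin.zero , b ; (inj₂ (c , b)) → Fin.suc c , b })
      (λ { (Fin.zero , b) → inj₁ b ; (Fin.suc c , b) → inj₂ (c , b) })
      (λ { (Fin.zero , b) → refl ; (Fin.suc c , b) → refl })
      (λ { (inj₁ b) → refl ; (inj₂ (c , b)) → refl })

  Fin-bit : ∀ x → Fin (bit x) ↔ T x
  Fin-bit true  = mk↔ₛ′ (λ _ → tt) (λ _ → Fin.zero) (λ _ → refl) (λ { Fin.zero → refl ; (Fin.suc ()) })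
  Fin-bit false = mk↔ₛ′ (λ ()) (λ ()) (λ ()) (λ ())

  Fin-count : ∀ m a b → Fin (count m a b) ↔ Code m a b
  Fin-count zero    a b = mk↔ₛ′ (λ _ → tt) (λ _ → Fin.zero) (λ _ → refl) (λ { Fin.zero → refl ; (Fin.suc ()) })
  Fin-count (suc m) a b = Fin-∑ _ λ c → Fin-∑ _ λ d →
    ↔-trans (Finₚ.*↔× {bit (noAscent a b (toℕ c) (toℕ d))}) (Fin-bit (noAscent a b (toℕ c) (toℕ d)) ×-↔
      ↔-trans (Finₚ.*↔× {q ℕ.^ toℕ c ℕ.* q ℕ.^ toℕ d}) (Finₚ.*↔× ×-↔ Fin-count m (toℕ c) (toℕ d)))

-- Dimension, membership and covers over a finite field

module LinearAlgebra {q : ℕ} (𝔽 : FiniteField q) (i : ℕ) where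
  open FiniteField 𝔽 using (Carrier; 0#; 1#; isCommutativeRing; 0≢1; inverse; card)
  open Lin 𝔽 i

  commutativeRing : CommutativeRing 0ℓ 0ℓ
  commutativeRing = record { isCommutativeRing = isCommutativeRing }

  open CommutativeRing commutativeRing public
    using (_+_; _*_; -_; +-identityˡ; +-identityʳ; *-identityˡ; *-identityʳ; zeroˡ; zeroʳ; *-assoc; *-comm;
           distribˡ; distribʳ; -‿inverseʳ; ring; +-group; +-commutativeSemigroup)
  open RingProperties ring public using (-‿distribˡ-*; -‿distribʳ-*; -0#≈0#; -1*x≈-x)
  open GroupProperties +-group public using ()
    renaming (x∙y⁻¹≈ε⇒x≈y to x-y≡0⇒x≡y; inverseʳ-unique to -‿unique; ⁻¹-involutive to -‿involutive)

  open CommutativeSemigroupProperties +-commutativeSemigroup public using (interchange; x∙yz≈y∙xz)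

  _≟F_ : DecidableEquality Carrier
  _≟F_ = via-injection (↔⇒↣ (↔-sym card)) Fin._≟_

  ax+[-a]x≡0 : ∀ a x → a * x + (- a) * x ≡ 0#
  ax+[-a]x≡0 a x = trans (sym (distribʳ x a (- a))) (trans (cong (_* x) (-‿inverseʳ a)) (zeroˡ x))

  -- 0 and 1 are distinct elements. The bound makes `q ^ d` strictly increasing in `d`, so
  -- dimensions can be compared by counting.
  2≤q : 2 ℕ.≤ q
  2≤q = Finₚ.injective⇒≤ {f = Inverse.from card ∘ f} λ {x} {y} eq →
    f-injective x y (Injection.injective (↔⇒↣ (↔-sym card)) eq)
    where
    f : Fin 2 → Carrier
    f Fin.zero = 0#
    f (Fin.suc _) = 1#
    f-injective : ∀ x y → f x ≡ f y → x ≡ y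
    f-injective Fin.zero Fin.zero _ = refl
    f-injective Fin.zero (Fin.suc _) e = contradiction e 0≢1
    f-injective (Fin.suc _) Fin.zero e = contradiction (sym e) 0≢1
    f-injective (Fin.suc Fin.zero) (Fin.suc Fin.zero) _ = refl

  -- Without function extensionality, coefficient functions are enumerated up to pointwise equality by Fin (q ^ d).
  fun : ∀ {d} → Fin (q ℕ.^ d) → Fin d → Carrier
  fun n j = Inverse.to card (Fin.finToFun n j)

  index : ∀ {d} → (Fin d → Carrier) → Fin (q ℕ.^ d)
  index f = Fin.funToFin (Inverse.from card ∘ f)

  funToFin-cong : ∀ {d n} (f g : Fin d → Fin n) → (∀ j → f j ≡ g j) → Fin.funToFin f ≡ Fin.funToFin g
  funToFin-cong {zero}  f g e = refl
  funToFin-cong {suc d} f g e = cong₂ Fin.combine (e Fin.zero) (funToFin-cong (f ∘ Fin.suc) (g ∘ Fin.suc) (e ∘ Fin.suc))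

  fun-index : ∀ {d} (f : Fin d → Carrier) j → fun (index f) j ≡ f j
  fun-index f j = trans
    (cong (Inverse.to card) (Finₚ.finToFun-funToFin (Inverse.from card ∘ f) j))
    (Inverse.strictlyInverseˡ card (f j))

  fun-injective : ∀ {d} (m n : Fin (q ℕ.^ d)) → (∀ j → fun m j ≡ fun n j) → m ≡ n
  fun-injective {d} m n e = begin
    m ≡⟨ sym (Finₚ.funToFin-finToFin {d} {q} m) ⟩
    Fin.funToFin {d} {q} (Fin.finToFun m)
      ≡⟨ funToFin-cong {d} {q} _ _ (λ j → Injection.injective (↔⇒↣ card) (e j)) ⟩
    Fin.funToFin {d} {q} (Fin.finToFun n) ≡⟨ Finₚ.funToFin-finToFin {d} {q} n ⟩
    n ∎
    where open ≡-Reasoning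

  ΣF-cong : ∀ {d} (f g : Fin d → Carrier) → (∀ j → f j ≡ g j) → ΣF f ≡ ΣF g
  ΣF-cong {zero}  f g e = refl
  ΣF-cong {suc d} f g e = cong₂ _+_ (e Fin.zero) (ΣF-cong (f ∘ Fin.suc) (g ∘ Fin.suc) (e ∘ Fin.suc))

  lincomb-cong : ∀ {d} (c c' : Fin d → Carrier) (b : Fin d → Vec) → (∀ j → c j ≡ c' j) → lincomb c b ≈ᵥ lincomb c' b
  lincomb-cong c c' b e k = ΣF-cong _ _ λ j → cong (_* b j k) (e j)

  lincomb-+ : ∀ {d} (c c' : Fin d → Carrier) (b : Fin d → Vec) →
    lincomb (λ j → c j + c' j) b ≈ᵥ (lincomb c b +ᵥ lincomb c' b)
  lincomb-+ {zero}  c c' b k = sym (+-identityˡ 0#)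
  lincomb-+ {suc d} c c' b k = trans
    (cong₂ _+_ (distribʳ (b Fin.zero k) (c Fin.zero) (c' Fin.zero)) (lincomb-+ (c ∘ Fin.suc) (c' ∘ Fin.suc) (b ∘ Fin.suc) k))
    (interchange _ _ _ _)

  lincomb-· : ∀ {d} a (c : Fin d → Carrier) (b : Fin d → Vec) →
    lincomb (λ j → a * c j) b ≈ᵥ (a ·ᵥ lincomb c b)
  lincomb-· {zero}  a c b k = sym (zeroʳ a)
  lincomb-· {suc d} a c b k = trans
    (cong₂ _+_ (*-assoc a (c Fin.zero) (b Fin.zero k)) (lincomb-· a (c ∘ Fin.suc) (b ∘ Fin.suc) k))
    (sym (distribˡ a _ _))

  coordinates-unique : ∀ {d} {b : Fin d → Vec} → LinIndep b →
    ∀ c c' → lincomb c b ≈ᵥ lincomb c' b → ∀ j → c j ≡ c' j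
  coordinates-unique {b = b} indep c c' e j = x-y≡0⇒x≡y (c j) (c' j)
    (trans (cong (λ x → c j + x) (sym (-1*x≈-x (c' j)))) (indep (λ j → c j + (- 1#) * c' j) vanish j))
    where
    open ≡-Reasoning
    vanish : lincomb (λ j → c j + (- 1#) * c' j) b ≈ᵥ 0ᵥ
    vanish k = begin
      lincomb (λ j → c j + (- 1#) * c' j) b k ≡⟨ lincomb-+ c (λ j → (- 1#) * c' j) b k ⟩
      lincomb c b k + lincomb (λ j → (- 1#) * c' j) b k ≡⟨ cong₂ _+_ (e k) (lincomb-· (- 1#) c' b k) ⟩
      lincomb c' b k + (- 1#) * lincomb c' b k ≡⟨ cong (_+ (- 1#) * lincomb c' b k) (sym (*-identityˡ _)) ⟩
      1# * lincomb c' b k + (- 1#) * lincomb c' b k ≡⟨ ax+[-a]x≡0 1# _ ⟩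
      0# ∎

  -- Counting replaces the exchange lemma: rewriting combinations of the basis of `X` in the basis
  -- of `Y` injects `q ^ r` coefficient vectors into `q ^ s`.
  ⊆⇒dim≤ : ∀ X Y {r s} → HasDim X r → HasDim Y s → X ⊆ Y → r ℕ.≤ s
  ⊆⇒dim≤ X Y {r} {s} (b , indep , spans) (b' , indep' , spans') X⊆Y =
    ^-cancel-≤ (Finₚ.injective⇒≤ {f = index ∘ coords} λ {m} {n} eq → fun-injective m n
      (coordinates-unique indep (fun m) (fun n) λ k → trans (coords-ok m k)
        (trans (lincomb-cong (coords m) (coords n) b'
          (λ j → trans (sym (fun-index (coords m) j)) (trans (cong (λ z → fun z j) eq) (fun-index (coords n) j))) k)
          (sym (coords-ok n k)))))
    where
    inY : ∀ n → ∃ λ c → lincomb (fun n) b ≈ᵥ lincomb c b'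
    inY n = proj₁ (spans' _) (X⊆Y _ (proj₂ (spans (lincomb (fun n) b)) (fun n , λ _ → refl)))
    coords : Fin (q ℕ.^ r) → Fin s → Carrier
    coords n = proj₁ (inY n)
    coords-ok : ∀ n → lincomb (fun n) b ≈ᵥ lincomb (coords n) b'
    coords-ok n = proj₂ (inY n)
    ^-cancel-≤ : q ℕ.^ r ℕ.≤ q ℕ.^ s → r ℕ.≤ s
    ^-cancel-≤ le with r ℕ.≤? s
    ... | yes p = p
    ... | no ¬p = contradiction le (ℕₚ.<⇒≱ (ℕₚ.^-monoʳ-< q 2≤q (ℕₚ.≰⇒> ¬p)))

  -- A `Subspace` is an arbitrary predicate, but a basis allows a search through its finitely many
  -- linear combinations.
  member? : ∀ X {r} → HasDim X r → ∀ v → Dec (X ∋ v)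
  member? X (b , indep , spans) v = map′
    (λ { (n , e) → proj₂ (spans v) (fun n , e) })
    (λ v∈X → let (c , e) = proj₁ (spans v) v∈X in
      index c , λ k → trans (e k) (lincomb-cong c (fun (index c)) b (λ j → sym (fun-index c j)) k))
    (Finₚ.any? λ n → Finₚ.all? λ k → v k ≟F lincomb (fun n) b k)

  -- The same search, over the combinations of the basis of `Y`, makes inclusion decidable and
  -- supplies the vector to adjoin when it fails.
  ⊆-or-witness : ∀ X Y {r s} → HasDim X r → HasDim Y s → (Y ⊆ X) ⊎ ∃ λ v → (Y ∋ v) × ¬ (X ∋ v)
  ⊆-or-witness X Y dX (b , indep , spans)
    with Finₚ.any? (λ n → ¬? (member? X dX (lincomb (fun n) b)))
  ... | yes (n , ∉X) = inj₂ (lincomb (fun n) b , proj₂ (spans _) (fun n , λ _ → refl) , ∉X)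
  ... | no none = inj₁ λ v v∈Y → let (c , e) = proj₁ (spans v) v∈Y in
    resp X (λ k → sym (trans (e k) (lincomb-cong c (fun (index c)) b (λ j → sym (fun-index c j)) k))) (inX (index c))
    where
    inX : ∀ n → X ∋ lincomb (fun n) b
    inX n with member? X dX (lincomb (fun n) b)
    ... | yes p = p
    ... | no ¬p = contradiction (n , ¬p) none

  _⊕⟨_⟩ : Subspace → Vec → Subspace
  X ⊕⟨ v ⟩ = record
    { _∋_    = λ w → ∃ λ a → ∃ λ u → (X ∋ u) × (w ≈ᵥ ((a ·ᵥ v) +ᵥ u))
    ; resp   = λ { e (a , u , u∈X , p) → a , u , u∈X , λ k → trans (sym (e k)) (p k) }
    ; has0   = 0# , 0ᵥ , has0 X , λ k → sym (trans (cong (_+ 0#) (zeroˡ (v k))) (+-identityˡ 0#))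
    ; close+ = λ { (a , u , u∈X , p) (a' , u' , u'∈X , p') → (a + a') , (u +ᵥ u') , close+ X u∈X u'∈X ,
        λ k → trans (cong₂ _+_ (p k) (p' k)) (trans (interchange _ _ _ _) (cong (_+ (u k + u' k)) (sym (distribʳ (v k) a a')))) }
    ; close· = λ { c (a , u , u∈X , p) → (c * a) , (c ·ᵥ u) , close· X c u∈X ,
        λ k → trans (cong (c *_) (p k)) (trans (distribˡ c _ _) (cong (_+ c * u k) (sym (*-assoc c a (v k))))) }
    }

  ⊕-⊆ : ∀ {X Y v} → X ⊆ Y → Y ∋ v → (X ⊕⟨ v ⟩) ⊆ Y
  ⊕-⊆ {Y = Y} X⊆Y v∈Y w (a , u , u∈X , e) = resp Y (λ k → sym (e k)) (close+ Y (close· Y a v∈Y) (X⊆Y u u∈X))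

  ⊆-⊕ : ∀ {X v} → X ⊆ (X ⊕⟨ v ⟩)
  ⊆-⊕ {X} {v} u u∈X = 0# , u , u∈X , λ k → sym (trans (cong (_+ u k) (zeroˡ (v k))) (+-identityˡ (u k)))

  ∈-⊕ : ∀ {X v} → (X ⊕⟨ v ⟩) ∋ v
  ∈-⊕ {X} {v} = 1# , 0ᵥ , has0 X , λ k → sym (trans (+-identityʳ _) (*-identityˡ (v k)))

  cons : ∀ {A : Set} {d} → A → (Fin d → A) → Fin (suc d) → A
  cons a c Fin.zero    = a
  cons a c (Fin.suc j) = c j

  ⊕-dim : ∀ X v {r} → HasDim X r → ¬ (X ∋ v) → HasDim (X ⊕⟨ v ⟩) (suc r)
  ⊕-dim X v {r} (b , indep , spans) v∉X = cons v b , indep' , λ w →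
      (λ { (a , u , u∈X , e) → let (c , e') = proj₁ (spans u) u∈X in
           cons a c , λ k → trans (e k) (cong (λ x → a * v k + x) (e' k)) })
    , (λ { (c , e) → c Fin.zero , lincomb (c ∘ Fin.suc) b , proj₂ (spans _) (c ∘ Fin.suc , λ _ → refl) , e })
    where
    open ≡-Reasoning
    indep' : LinIndep (cons v b)
    indep' c e = all-zero
      where
      rest : Fin r → Carrier
      rest = c ∘ Fin.suc
      head-zero : c Fin.zero ≡ 0#
      head-zero with c Fin.zero ≟F 0#
      ... | yes p = p
      -- A nonzero coefficient with inverse `y` would make `v` equal to `- y` times a vector of `X`.
      ... | no c₀≢0 = contradiction (resp X v-comb (close· X (- y) (proj₂ (spans (lincomb rest b)) (rest , λ _ → refl)))) v∉X
        where
        c₀ y : Carrier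
        c₀ = c Fin.zero
        y = proj₁ (inverse c₀ c₀≢0)
        v-comb : ((- y) ·ᵥ lincomb rest b) ≈ᵥ v
        v-comb k = begin
          (- y) * lincomb rest b k ≡⟨ cong ((- y) *_) (-‿unique (c₀ * v k) (lincomb rest b k) (e k)) ⟩
          (- y) * (- (c₀ * v k)) ≡⟨ cong ((- y) *_) (-‿distribˡ-* c₀ (v k)) ⟩
          (- y) * ((- c₀) * v k) ≡⟨ sym (*-assoc (- y) (- c₀) (v k)) ⟩
          ((- y) * (- c₀)) * v k
            ≡⟨ cong (_* v k) (trans (sym (-‿distribˡ-* y (- c₀))) (cong -_ (sym (-‿distribʳ-* y c₀)))) ⟩
          (- (- (y * c₀))) * v k ≡⟨ cong (_* v k) (-‿involutive (y * c₀)) ⟩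
          (y * c₀) * v k ≡⟨ cong (_* v k) (trans (*-comm y c₀) (proj₂ (inverse c₀ c₀≢0))) ⟩
          1# * v k ≡⟨ *-identityˡ (v k) ⟩
          v k ∎
      tail-comb : lincomb rest b ≈ᵥ 0ᵥ
      tail-comb k = begin
        lincomb rest b k ≡⟨ sym (+-identityˡ _) ⟩
        0# + lincomb rest b k ≡⟨ cong (_+ lincomb rest b k) (sym (trans (cong (_* v k) head-zero) (zeroˡ (v k)))) ⟩
        c Fin.zero * v k + lincomb rest b k ≡⟨ e k ⟩
        0# ∎
      all-zero : ∀ j → c j ≡ 0#
      all-zero Fin.zero = head-zero
      all-zero (Fin.suc j) = indep rest tail-comb j

  HasDim-resp : ∀ X Y {r} → X ≐ Y → HasDim X r → HasDim Y r
  HasDim-resp X Y (X⊆Y , Y⊆X) (b , indep , spans) = b , indep , λ v →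
    (λ v∈Y → proj₁ (spans v) (Y⊆X v v∈Y)) , (λ c → X⊆Y v (proj₂ (spans v) c))

  -- One component must grow properly; adjoining a witness there gives a subspace of dimension
  -- `suc (rank x)` inside that component of `y`. The rank is common to both components.
  <S⇒rank< : ∀ {x y} → x <S y → rank x ℕ.< rank y
  <S⇒rank< {x} {y} ((p , p') , y≰x)
    with ⊆-or-witness (fst x) (fst y) (dimFst x) (dimFst y) | ⊆-or-witness (snd x) (snd y) (dimSnd x) (dimSnd y)
  ... | inj₂ (v , v∈ , v∉) | _ =
    ⊆⇒dim≤ (fst x ⊕⟨ v ⟩) (fst y) (⊕-dim (fst x) v (dimFst x) v∉) (dimFst y) (⊕-⊆ {fst x} {fst y} p v∈)
  ... | inj₁ _ | inj₂ (v , v∈ , v∉) =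
    ⊆⇒dim≤ (snd x ⊕⟨ v ⟩) (snd y) (⊕-dim (snd x) v (dimSnd x) v∉) (dimSnd y) (⊕-⊆ {snd x} {snd y} p' v∈)
  ... | inj₁ r | inj₁ r' = contradiction (r , r') y≰x

  rank-suc⇒⋖S : ∀ {x y} → x ≤S y → rank y ≡ suc (rank x) → x ⋖S y
  rank-suc⇒⋖S {x} {y} x≤y eq =
      (x≤y , λ y≤x → contradiction (⊆⇒dim≤ (fst y) (fst x) (dimFst y) (dimFst x) (proj₁ y≤x))
        (ℕₚ.<⇒≱ (ℕₚ.≤-reflexive (sym eq))))
    , λ { (z , x<z , z<y) → contradiction (ℕₚ.≤-trans (s≤s (<S⇒rank< {x} {z} x<z)) (<S⇒rank< {z} {y} z<y))
                              (ℕₚ.<⇒≱ (s≤s (ℕₚ.≤-reflexive eq))) }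

  -- Since the rank rises, both components grow. Adjoining one new vector to each gives `z`, again
  -- of equal dimensions, above `x` and below `y`; as nothing lies strictly between, `z` is `y`.
  ⋖S⇒⊕ : ∀ {x y} → x ⋖S y → ∃ λ v → ∃ λ w →
    (¬ (fst x ∋ v) × fst y ≐ (fst x ⊕⟨ v ⟩)) × (¬ (snd x ∋ w) × snd y ≐ (snd x ⊕⟨ w ⟩))
  ⋖S⇒⊕ {x} {y} (x<y@((p , p') , y≰x) , none)
    with ⊆-or-witness (fst x) (fst y) (dimFst x) (dimFst y) | ⊆-or-witness (snd x) (snd y) (dimSnd x) (dimSnd y)
  ... | inj₁ r | _ = contradiction (⊆⇒dim≤ (fst y) (fst x) (dimFst y) (dimFst x) r) (ℕₚ.<⇒≱ (<S⇒rank< {x} {y} x<y))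
  ... | inj₂ _ | inj₁ r = contradiction (⊆⇒dim≤ (snd y) (snd x) (dimSnd y) (dimSnd x) r) (ℕₚ.<⇒≱ (<S⇒rank< {x} {y} x<y))
  ... | inj₂ (v , v∈ , v∉) | inj₂ (w , w∈ , w∉) =
    v , w , (v∉ , proj₁ y≤z , proj₁ z≤y) , (w∉ , proj₂ y≤z , proj₂ z≤y)
    where
    z : SegreElt
    z = ⟨ fst x ⊕⟨ v ⟩ , snd x ⊕⟨ w ⟩ , suc (rank x) , ⊕-dim (fst x) v (dimFst x) v∉ , ⊕-dim (snd x) w (dimSnd x) w∉ ⟩
    x<z : x <S z
    x<z = (⊆-⊕ {fst x} {v} , ⊆-⊕ {snd x} {w}) , λ z≤x → v∉ (proj₁ z≤x v (∈-⊕ {fst x} {v}))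
    z≤y : z ≤S y
    z≤y = ⊕-⊆ {fst x} {fst y} p v∈ , ⊕-⊆ {snd x} {snd y} p' w∈
    y≤z : y ≤S z
    y≤z with ⊆-or-witness (fst z) (fst y) (dimFst z) (dimFst y) | ⊆-or-witness (snd z) (snd y) (dimSnd z) (dimSnd y)
    ... | inj₁ r | inj₁ r' = r , r'
    ... | inj₂ (u , u∈ , u∉) | _ = contradiction (z , x<z , z≤y , λ y≤z → u∉ (proj₁ y≤z u u∈)) none
    ... | inj₁ _ | inj₂ (u , u∈ , u∉) = contradiction (z , x<z , z≤y , λ y≤z → u∉ (proj₂ y≤z u u∈)) none

-- Subspaces as kernels of normalised linear maps

module Frames {q : ℕ} (𝔽 : FiniteField q) (i : ℕ) where
  open FiniteField 𝔽 using (Carrier; 0#; 1#; 0≢1; inverse)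
  open Lin 𝔽 i
  open LinearAlgebra 𝔽 i

  -- The canonical generator of a line: `c` is its rightmost nonzero position, and the entries `x`
  -- before it are free.
  monic : ∀ {n} (c : Fin n) → (Fin (toℕ c) → Carrier) → Fin n → Carrier
  monic Fin.zero    x Fin.zero    = 1#
  monic Fin.zero    x (Fin.suc l) = 0#
  monic (Fin.suc c) x Fin.zero    = x Fin.zero
  monic (Fin.suc c) x (Fin.suc l) = monic c (x ∘ Fin.suc) l

  monic-pivot : ∀ {n} (c : Fin n) x → monic c x c ≡ 1#
  monic-pivot Fin.zero    x = refl
  monic-pivot (Fin.suc c) x = monic-pivot c (x ∘ Fin.suc)

  monic-above : ∀ {n} (c : Fin n) x l → c Fin.< l → monic c x l ≡ 0#
  monic-above Fin.zero    x (Fin.suc l) _ = refl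
  monic-above (Fin.suc c) x (Fin.suc l) (s≤s c<l) = monic-above c (x ∘ Fin.suc) l c<l

  monic-injective : ∀ {n} (c : Fin n) x y → (∀ l → monic c x l ≡ monic c y l) → ∀ j → x j ≡ y j
  monic-injective (Fin.suc c) x y e Fin.zero    = e Fin.zero
  monic-injective (Fin.suc c) x y e (Fin.suc j) = monic-injective c (x ∘ Fin.suc) (y ∘ Fin.suc) (e ∘ Fin.suc) j

  monic-cong : ∀ {n} (c : Fin n) x y → (∀ j → x j ≡ y j) → ∀ l → monic c x l ≡ monic c y l
  monic-cong Fin.zero    x y e Fin.zero    = refl
  monic-cong Fin.zero    x y e (Fin.suc l) = refl
  monic-cong (Fin.suc c) x y e Fin.zero    = e Fin.zero
  monic-cong (Fin.suc c) x y e (Fin.suc l) = monic-cong c (x ∘ Fin.suc) (y ∘ Fin.suc) (e ∘ Fin.suc) l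

  monic-surjective : ∀ {n} (c : Fin n) (u : Fin n → Carrier) → u c ≡ 1# → (∀ l → c Fin.< l → u l ≡ 0#) →
    ∃ λ x → ∀ l → monic c x l ≡ u l
  monic-surjective Fin.zero u one above = (λ ()) , λ
    { Fin.zero → sym one ; (Fin.suc l) → sym (above (Fin.suc l) (s≤s z≤n)) }
  monic-surjective (Fin.suc c) u one above =
    let (x , e) = monic-surjective c (u ∘ Fin.suc) one (λ l c<l → above (Fin.suc l) (s≤s c<l)) in
    cons (u Fin.zero) x , λ { Fin.zero → refl ; (Fin.suc l) → e l }

  rightmost : ∀ {n} (y : Fin n → Carrier) → (∀ c → y c ≡ 0#) ⊎ ∃ λ c → y c ≢ 0# × (∀ l → c Fin.< l → y l ≡ 0#)
  rightmost {zero} y = inj₁ λ ()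
  rightmost {suc n} y with rightmost (y ∘ Fin.suc) | y Fin.zero ≟F 0#
  ... | inj₂ (c , yc≢0 , above) | _ = inj₂ (Fin.suc c , yc≢0 , λ { (Fin.suc l) (s≤s c<l) → above l c<l })
  ... | inj₁ z | yes p = inj₁ λ { Fin.zero → p ; (Fin.suc c) → z c }
  ... | inj₁ z | no ¬p = inj₂ (Fin.zero , ¬p , λ { (Fin.suc l) _ → z l })

  punchIn-mono-< : ∀ {n} (c : Fin (suc n)) {l l'} → l Fin.< l' → punchIn c l Fin.< punchIn c l'
  punchIn-mono-< c {l} {l'} l<l' = ℕₚ.≰⇒> λ le → ℕₚ.<⇒≱ l<l' (Finₚ.punchIn-cancel-≤ c l' l le)

  -- This is the Lehmer code comparison: once the label of rank `c` is removed, the new rank `c'`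
  -- stands for the old rank `punchIn c c'`, so a weak inequality of codes is a strict inequality of
  -- labels.
  ≤⇒<punchIn : ∀ {n} (c : Fin (suc n)) c' → toℕ c ℕ.≤ toℕ c' → c Fin.< punchIn c c'
  ≤⇒<punchIn Fin.zero    c'           _        = s≤s z≤n
  ≤⇒<punchIn (Fin.suc c) (Fin.suc c') (s≤s le) = s≤s (≤⇒<punchIn c c' le)

  ≤punchIn⇒≤ : ∀ {n} (c : Fin (suc n)) c' → c Fin.≤ punchIn c c' → toℕ c ℕ.≤ toℕ c'
  ≤punchIn⇒≤ Fin.zero    c'           _        = z≤n
  ≤punchIn⇒≤ (Fin.suc c) (Fin.suc c') (s≤s le) = s≤s (≤punchIn⇒≤ c c' le)

  punchIn-view : ∀ {n} (c l : Fin (suc n)) → (l ≡ c) ⊎ ∃ λ l' → l ≡ punchIn c l'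
  punchIn-view c l with c Fin.≟ l
  ... | yes p = inj₁ (sym p)
  ... | no ¬p = inj₂ (Fin.punchOut ¬p , sym (Finₚ.punchIn-punchOut ¬p))

  -- A subspace X of codimension m is presented as the kernel of π : 𝔽ⁱ → 𝔽ᵐ, normalised so that π restricts
  -- to the identity on the span of the coordinate vectors e_(ρ c), where ρ enumerates the complement of f(A(X)).
  record Frame (m : ℕ) : Set where
    field
      ρ : Fin m → Fin i
      ρ-mono : ∀ {c d} → c Fin.< d → ρ c Fin.< ρ d
      π : Vec → Fin m → Carrier
      π-cong : ∀ {u v} → u ≈ᵥ v → ∀ c → π u c ≡ π v c
      π-+ : ∀ u v c → π (u +ᵥ v) c ≡ π u c + π v c
      π-· : ∀ a v c → π (a ·ᵥ v) c ≡ a * π v c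
      triangular : ∀ v c → (∀ k → ρ c Fin.< k → v k ≡ 0#) → π v c ≡ v (ρ c)
      section : ∀ v → (∀ k → (∃ λ c → k ≡ ρ c) ⊎ v k ≡ 0#) → ∀ c → π v c ≡ v (ρ c)

    ker : Subspace
    ker = record
      { _∋_    = λ v → ∀ c → π v c ≡ 0#
      ; resp   = λ e p c → trans (sym (π-cong e c)) (p c)
      ; has0   = λ c → section 0ᵥ (λ _ → inj₂ refl) c
      ; close+ = λ {u} {v} p r c → trans (π-+ u v c) (trans (cong₂ _+_ (p c) (r c)) (+-identityˡ 0#))
      ; close· = λ a {v} p c → trans (π-· a v c) (trans (cong (a *_) (p c)) (zeroʳ a))
      }

    ρ-injective : ∀ {c d} → ρ c ≡ ρ d → c ≡ d
    ρ-injective {c} {d} e with Finₚ.<-cmp c d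
    ... | tri< c<d _ _ = contradiction (ρ-mono c<d) (ℕₚ.<-irrefl (cong toℕ e))
    ... | tri≈ _ c≡d _ = c≡d
    ... | tri> _ _ d<c = contradiction (ρ-mono d<c) (ℕₚ.<-irrefl (cong toℕ (sym e)))

    ρ-cancel-≤ : ∀ {c d} → ρ c Fin.≤ ρ d → c Fin.≤ d
    ρ-cancel-≤ le = ℕₚ.≮⇒≥ λ d<c → ℕₚ.<⇒≱ (ρ-mono d<c) le

    image? : ∀ k → Dec (∃ λ c → k ≡ ρ c)
    image? k = Finₚ.any? λ c → k Fin.≟ ρ c

    lift : (Fin m → Carrier) → Vec
    lift y k with image? k
    ... | yes (c , _) = y c
    ... | no _ = 0#

    lift-ρ : ∀ y c → lift y (ρ c) ≡ y c
    lift-ρ y c with image? (ρ c)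
    ... | yes (c' , e) = cong y (sym (ρ-injective e))
    ... | no ¬p = contradiction (c , refl) ¬p

    lift-outside : ∀ y k → ¬ (∃ λ c → k ≡ ρ c) → lift y k ≡ 0#
    lift-outside y k ¬p with image? k
    ... | yes p = contradiction p ¬p
    ... | no _ = refl

    π-lift : ∀ y c → π (lift y) c ≡ y c
    π-lift y c = trans (section (lift y) supported c) (lift-ρ y c)
      where
      supported : ∀ k → (∃ λ c → k ≡ ρ c) ⊎ lift y k ≡ 0#
      supported k with image? k
      ... | yes p = inj₁ p
      ... | no _ = inj₂ refl

    -- By `triangular`, a vector whose last nonzero coordinate is `ρ c` has a nonzero value of `π`
    -- at `c`.
    ¬InFA-ρ : ∀ c → ¬ InFA ker (ρ c)
    ¬InFA-ρ c (v , v∈ , _ , v≢0 , above) = v≢0 (trans (sym (triangular v c above)) (v∈ c))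

    δ : Fin i → Vec
    δ j k with j Fin.≟ k
    ... | yes _ = 1#
    ... | no _ = 0#

    δ-diag : ∀ j → δ j j ≡ 1#
    δ-diag j with j Fin.≟ j
    ... | yes _ = refl
    ... | no ¬p = contradiction refl ¬p

    δ-off : ∀ j k → j ≢ k → δ j k ≡ 0#
    δ-off j k j≢k with j Fin.≟ k
    ... | yes p = contradiction p j≢k
    ... | no _ = refl

    -- Subtracting from the coordinate vector `δ j` the lift of its image gives a kernel vector. Its
    -- last nonzero coordinate stays at `j`, because by `triangular` the image vanishes at every `c`
    -- with `ρ c` beyond `j`.
    InFA-outside : ∀ j → ¬ (∃ λ c → j ≡ ρ c) → InFA ker j
    InFA-outside j j∉ = v , v∈ker , (λ z → vj≢0 (z j)) , vj≢0 , above
      where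
      open ≡-Reasoning
      y : Fin m → Carrier
      y c = (- 1#) * π (δ j) c
      v : Vec
      v = δ j +ᵥ lift y
      vj : v j ≡ 1#
      vj = trans (cong₂ _+_ (δ-diag j) (lift-outside y j j∉)) (+-identityʳ 1#)
      vj≢0 : v j ≢ 0#
      vj≢0 e = 0≢1 (trans (sym e) vj)
      v∈ker : ∀ c → π v c ≡ 0#
      v∈ker c = begin
        π v c ≡⟨ π-+ (δ j) (lift y) c ⟩
        π (δ j) c + π (lift y) c ≡⟨ cong₂ _+_ (sym (*-identityˡ _)) (π-lift y c) ⟩
        1# * π (δ j) c + (- 1#) * π (δ j) c ≡⟨ ax+[-a]x≡0 1# _ ⟩
        0# ∎
      y-zero : ∀ c → j Fin.< ρ c → y c ≡ 0#
      y-zero c j<ρc = trans (cong ((- 1#) *_) (trans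
        (triangular (δ j) c (λ k ρc<k → δ-off j k λ { refl → ℕₚ.<-asym j<ρc ρc<k }))
        (δ-off j (ρ c) λ e → ℕₚ.<-irrefl (cong toℕ e) j<ρc))) (zeroʳ (- 1#))
      lift-zero : ∀ k → j Fin.< k → lift y k ≡ 0#
      lift-zero k j<k with image? k
      ... | yes (c , refl) = y-zero c j<k
      ... | no _ = refl
      above : ∀ k → j Fin.< k → v k ≡ 0#
      above k j<k = trans (cong₂ _+_ (δ-off j k λ { refl → ℕₚ.<-irrefl refl j<k }) (lift-zero k j<k)) (+-identityˡ 0#)

  -- Enlarging the kernel by a line

  open Frame

  start : Frame i
  start = record
    { ρ = id ; ρ-mono = id ; π = id ; π-cong = id
    ; π-+ = λ _ _ _ → refl ; π-· = λ _ _ _ → refl ; triangular = λ _ _ _ → refl ; section = λ _ _ _ → refl }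

  start-dim : HasDim (ker start) 0
  start-dim = (λ ()) , (λ _ _ ()) , λ v → (λ v∈ → (λ ()) , v∈) , (λ { (_ , e) → e })

  -- `π` is followed by the quotient by the line of `u = monic c x`, namely the map sending `y` to
  -- the entries `y l - y c * u l` for `l` other than `c`; accordingly `ρ` loses `ρ c`.
  step : ∀ {m} → Frame (suc m) → (c : Fin (suc m)) → (Fin (toℕ c) → Carrier) → Frame m
  step {m} F c x = record
    { ρ = ρ F ∘ punchIn c
    ; ρ-mono = λ l<l' → ρ-mono F (punchIn-mono-< c l<l')
    ; π = π'
    ; π-cong = λ e l → cong₂ (λ a b → a + b * (- monic c x (punchIn c l))) (π-cong F e (punchIn c l)) (π-cong F e c)
    ; π-+ = λ u v l → trans 
        (cong₂ (λ a b → a + b * (- monic c x (punchIn c l))) (π-+ F u v (punchIn c l)) (π-+ F u v c))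
        (trans (cong (λ a → π F u (punchIn c l) + π F v (punchIn c l) + a) (distribʳ _ _ _)) (interchange _ _ _ _))
    ; π-· = λ a v l → trans 
        (cong₂ (λ p b → p + b * (- monic c x (punchIn c l))) (π-· F a v (punchIn c l)) (π-· F a v c))
        (trans (cong (λ b → a * π F v (punchIn c l) + b) (*-assoc a _ _)) (sym (distribˡ a _ _)))
    ; triangular = triangular'
    ; section = λ v supp l → drop v l (trans (section F v (weaken v supp) c) (at-c v supp)) (section F v (weaken v supp) (punchIn c l))
    }
    where
    π' : Vec → Fin m → Carrier
    π' v l = π F v (punchIn c l) + π F v c * (- monic c x (punchIn c l))
    drop : ∀ v l → π F v c ≡ 0# → π F v (punchIn c l) ≡ v (ρ F (punchIn c l)) → π' v l ≡ v (ρ F (punchIn c l))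
    drop v l z e = trans (cong₂ (λ a b → a + b * (- monic c x (punchIn c l))) e z)
      (trans (cong (λ a → v (ρ F (punchIn c l)) + a) (zeroˡ _)) (+-identityʳ _))
    triangular' : ∀ v l → (∀ k → ρ F (punchIn c l) Fin.< k → v k ≡ 0#) → π' v l ≡ v (ρ F (punchIn c l))
    -- The correction term vanishes: if the pivot `c` comes first, the entry of `monic` beyond it is
    -- 0; if it comes later, `v` is 0 at `ρ c`.
    triangular' v l above with Finₚ.<-cmp c (punchIn c l)
    ... | tri< c<l _ _ = trans (cong₂ (λ a b → a + π F v c * b) (triangular F v (punchIn c l) above)
                            (trans (cong -_ (monic-above c x (punchIn c l) c<l)) -0#≈0#))
                          (trans (cong (λ a → v (ρ F (punchIn c l)) + a) (zeroʳ _)) (+-identityʳ _))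
    ... | tri≈ _ e _ = contradiction (sym e) (Finₚ.punchInᵢ≢i c l)
    ... | tri> _ _ l<c = drop v l
      (trans (triangular F v c λ k lt → above k (ℕₚ.<-trans (ρ-mono F l<c) lt)) (above _ (ρ-mono F l<c)))
      (triangular F v (punchIn c l) above)
    weaken : ∀ v → (∀ k → (∃ λ l → k ≡ ρ F (punchIn c l)) ⊎ v k ≡ 0#) →
      ∀ k → (∃ λ l → k ≡ ρ F l) ⊎ v k ≡ 0#
    weaken v supp k with supp k
    ... | inj₁ (l , e) = inj₁ (punchIn c l , e)
    ... | inj₂ z = inj₂ z
    at-c : ∀ v → (∀ k → (∃ λ l → k ≡ ρ F (punchIn c l)) ⊎ v k ≡ 0#) → v (ρ F c) ≡ 0#
    at-c v supp with supp (ρ F c)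
    ... | inj₁ (l , e) = contradiction (sym (ρ-injective F e)) (Finₚ.punchInᵢ≢i c l)
    ... | inj₂ z = z

  module _ {m} (F : Frame (suc m)) (c : Fin (suc m)) (x : Fin (toℕ c) → Carrier) where

    ker-step⇒ : ∀ v → ker (step F c x) ∋ v → ∀ l → π F v l ≡ π F v c * monic c x l
    ker-step⇒ v v∈ l with punchIn-view c l
    ... | inj₁ refl = sym (trans (cong (π F v c *_) (monic-pivot c x)) (*-identityʳ _))
    ... | inj₂ (l' , refl) = x-y≡0⇒x≡y _ _ (trans (cong (λ a → π F v (punchIn c l') + a) (-‿distribʳ-* _ _)) (v∈ l'))

    ker-step⇐ : ∀ v a → (∀ l → π F v l ≡ a * monic c x l) → ker (step F c x) ∋ v
    ker-step⇐ v a e l = begin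
      π F v (punchIn c l) + π F v c * (- u)
        ≡⟨ cong₂ (λ p r → p + r * (- u)) (e (punchIn c l)) (trans (e c) (trans (cong (a *_) (monic-pivot c x)) (*-identityʳ a))) ⟩
      a * u + a * (- u) ≡⟨ sym (distribˡ a u (- u)) ⟩
      a * (u + (- u)) ≡⟨ cong (a *_) (-‿inverseʳ u) ⟩
      a * 0# ≡⟨ zeroʳ a ⟩
      0# ∎
      where
      open ≡-Reasoning
      u : Carrier
      u = monic c x (punchIn c l)

    -- A vector `w` of the new kernel has image `a` times the monic vector, hence `a * b⁻¹` times
    -- the image of `v`; subtracting that multiple of `v` leaves an element of `ker F`.
    ker-step-⊕ : ∀ v b → b ≢ 0# → (∀ l → π F v l ≡ b * monic c x l) → (ker F ⊕⟨ v ⟩) ≐ ker (step F c x)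
    ker-step-⊕ v b b≢0 e = ⇒ , ⇐
      where
      open ≡-Reasoning
      ⇒ : (ker F ⊕⟨ v ⟩) ⊆ ker (step F c x)
      ⇒ w (a , u , u∈ , p) = ker-step⇐ w (a * b) λ l → begin
        π F w l ≡⟨ π-cong F p l ⟩
        π F ((a ·ᵥ v) +ᵥ u) l ≡⟨ π-+ F (a ·ᵥ v) u l ⟩
        π F (a ·ᵥ v) l + π F u l ≡⟨ cong₂ _+_ (trans (π-· F a v l) (cong (a *_) (e l))) (u∈ l) ⟩
        a * (b * monic c x l) + 0# ≡⟨ trans (+-identityʳ _) (sym (*-assoc a b _)) ⟩
        (a * b) * monic c x l ∎
      b⁻¹ : Carrier
      b⁻¹ = proj₁ (inverse b b≢0)
      ⇐ : ker (step F c x) ⊆ (ker F ⊕⟨ v ⟩)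
      ⇐ w w∈ = s , u , u∈ , λ k → sym (begin
          s * v k + (w k + (- s) * v k) ≡⟨ x∙yz≈y∙xz _ _ _ ⟩
          w k + (s * v k + (- s) * v k) ≡⟨ cong (λ y → w k + y) (ax+[-a]x≡0 s (v k)) ⟩
          w k + 0# ≡⟨ +-identityʳ _ ⟩
          w k ∎)
        where
        a s : Carrier
        a = π F w c
        s = a * b⁻¹
        u : Vec
        u = w +ᵥ ((- s) ·ᵥ v)
        sb : s * b ≡ a
        sb = trans (*-assoc a b⁻¹ b) (trans (cong (a *_) (trans (*-comm b⁻¹ b) (proj₂ (inverse b b≢0)))) (*-identityʳ a))
        u∈ : ∀ l → π F u l ≡ 0#
        u∈ l = begin
          π F u l ≡⟨ π-+ F w ((- s) ·ᵥ v) l ⟩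
          π F w l + π F ((- s) ·ᵥ v) l
            ≡⟨ cong₂ _+_ (ker-step⇒ w w∈ l) (trans (π-· F (- s) v l) (cong ((- s) *_) (e l))) ⟩
          a * monic c x l + (- s) * (b * monic c x l)
            ≡⟨ cong (λ y → y * monic c x l + (- s) * (b * monic c x l)) (sym sb) ⟩
          (s * b) * monic c x l + (- s) * (b * monic c x l) ≡⟨ cong (_+ (- s) * (b * monic c x l)) (*-assoc s b _) ⟩
          s * (b * monic c x l) + (- s) * (b * monic c x l) ≡⟨ ax+[-a]x≡0 s _ ⟩
          0# ∎

    pivotVector : Vec
    pivotVector = lift F (monic c x)

    pivotVector∉ker : ¬ (ker F ∋ pivotVector)
    pivotVector∉ker p = 0≢1 (trans (sym (p c)) (trans (π-lift F (monic c x) c) (monic-pivot c x)))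

    pivotVector∈step : ker (step F c x) ∋ pivotVector
    pivotVector∈step = ker-step⇐ pivotVector 1# λ l → trans (π-lift F (monic c x) l) (sym (*-identityˡ _))

    ker⊆step : ker F ⊆ ker (step F c x)
    ker⊆step v v∈ = ker-step⇐ v 0# λ l → trans (v∈ l) (sym (zeroˡ _))

    step-dim : ∀ {r} → HasDim (ker F) r → HasDim (ker (step F c x)) (suc r)
    step-dim dF = HasDim-resp (ker F ⊕⟨ pivotVector ⟩) (ker (step F c x))
      (ker-step-⊕ pivotVector 1# (λ e → 0≢1 (sym e)) λ l → trans (π-lift F (monic c x) l) (sym (*-identityˡ _)))
      (⊕-dim (ker F) pivotVector dF pivotVector∉ker)

    -- By `InFA-outside` and `¬InFA-ρ` the set f(A(ker F)) is the complement of the image of `ρ`,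
    -- and `step` removes just `ρ c` from that image. `Label⇒ρ` is the uniqueness half.
    Label-ρ : Label (ker F) (ker (step F c x)) (ρ F c)
    Label-ρ = InFA-outside (step F c x) (ρ F c) (λ { (l , e) → Finₚ.punchInᵢ≢i c l (sym (ρ-injective F e)) }) , ¬InFA-ρ F c

    Label⇒ρ : ∀ j → Label (ker F) (ker (step F c x)) j → j ≡ ρ F c
    Label⇒ρ j (new , old) with image? F j
    ... | no ¬p = contradiction (InFA-outside F j ¬p) old
    ... | yes (l , refl) with punchIn-view c l
    ...   | inj₁ refl = refl
    ...   | inj₂ (l' , refl) = contradiction new (¬InFA-ρ (step F c x) l')

  -- The image of `v` is nonzero; dividing it by its rightmost nonzero entry makes it monic.
  step-cover : ∀ {m} (F : Frame (suc m)) v → ¬ (ker F ∋ v) →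
    ∃ λ c → Σ (Fin (q ℕ.^ toℕ c)) λ n → (ker F ⊕⟨ v ⟩) ≐ ker (step F c (fun n))
  step-cover F v v∉ with rightmost (π F v)
  ... | inj₁ v∈ = contradiction v∈ v∉
  ... | inj₂ (c , b≢0 , above) = c , index x , ker-step-⊕ F c (fun (index x)) v b b≢0 scaled
    where
    open ≡-Reasoning
    b b⁻¹ : Carrier
    b = π F v c
    b⁻¹ = proj₁ (inverse b b≢0)
    normalised : ∃ λ x → ∀ l → monic c x l ≡ b⁻¹ * π F v l
    normalised = monic-surjective c (λ l → b⁻¹ * π F v l) (trans (*-comm b⁻¹ b) (proj₂ (inverse b b≢0)))
      (λ l c<l → trans (cong (b⁻¹ *_) (above l c<l)) (zeroʳ b⁻¹))
    x : Fin (toℕ c) → Carrier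
    x = proj₁ normalised
    scaled : ∀ l → π F v l ≡ b * monic c (fun (index x)) l
    scaled l = sym (begin
      b * monic c (fun (index x)) l ≡⟨ cong (b *_) (trans (monic-cong c _ x (fun-index x) l) (proj₂ normalised l)) ⟩
      b * (b⁻¹ * π F v l) ≡⟨ sym (*-assoc b b⁻¹ _) ⟩
      (b * b⁻¹) * π F v l ≡⟨ cong (_* π F v l) (proj₂ (inverse b b≢0)) ⟩
      1# * π F v l ≡⟨ *-identityˡ _ ⟩
      π F v l ∎)

  -- The label recovers the pivot. Then both monic vectors span one line, and their common pivot
  -- entry 1 forces the scalar to be 1.
  step-injective : ∀ {m} (F : Frame (suc m)) c c' (n : Fin (q ℕ.^ toℕ c)) (n' : Fin (q ℕ.^ toℕ c')) →
    ker (step F c (fun n)) ≐ ker (step F c' (fun n')) →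
    _≡_ {A = Σ (Fin (suc m)) λ c → Fin (q ℕ.^ toℕ c)} (c , n) (c' , n')
  step-injective F c c' n n' (sub , sup) with same-pivot
    where
    same-pivot : c ≡ c'
    same-pivot = ρ-injective F (Label⇒ρ F c' (fun n') (ρ F c)
      (let ((v , v∈ , p) , old) = Label-ρ F c (fun n) in (v , sub v v∈ , p) , old))
  ... | refl = cong (c ,_) (fun-injective n n' (monic-injective c (fun n) (fun n') same-vector))
    where
    open ≡-Reasoning
    v : Vec
    v = pivotVector F c (fun n)
    same-vector : ∀ l → monic c (fun n) l ≡ monic c (fun n') l
    same-vector l = begin
      monic c (fun n) l ≡⟨ sym (π-lift F (monic c (fun n)) l) ⟩
      π F v l ≡⟨ ker-step⇒ F c (fun n') v (sub v (pivotVector∈step F c (fun n))) l ⟩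
      π F v c * monic c (fun n') l
        ≡⟨ cong (_* monic c (fun n') l) (trans (π-lift F (monic c (fun n)) c) (monic-pivot c (fun n))) ⟩
      1# * monic c (fun n') l ≡⟨ *-identityˡ _ ⟩
      monic c (fun n') l ∎

-- Descending chains and their codes

T-noAscent⇒ : ∀ a b c d → T (noAscent a b c d) → ¬ (a ℕ.≤ c × b ℕ.≤ d)
T-noAscent⇒ a b c d t (a≤c , b≤d) with a ≤ᵗ c | b ≤ᵗ d | ℕₚ.<⇒<ᵇ (s≤s a≤c) | ℕₚ.<⇒<ᵇ (s≤s b≤d)
... | true | true | _ | _ = t

T-noAscent⇐ : ∀ a b c d → ¬ (a ℕ.≤ c × b ℕ.≤ d) → T (noAscent a b c d)
T-noAscent⇐ a b c d ¬p with a ≤ᵗ c in eq | b ≤ᵗ d in eq'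
... | true  | true  = ¬p (ℕₚ.≤-pred (ℕₚ.<ᵇ⇒< a (suc c) (subst T (sym eq) tt)) ,
                         ℕₚ.≤-pred (ℕₚ.<ᵇ⇒< b (suc d) (subst T (sym eq') tt)))
... | true  | false = tt
... | false | _     = tt

module Chains {q : ℕ} (𝔽 : FiniteField q) (i : ℕ) where
  open Lin 𝔽 i
  open LinearAlgebra 𝔽 i
  open Frames 𝔽 i
  open Frame
  open Codes q
  open Count q using () renaming (count to codeCount)

  ≈S-sym : ∀ {x y} → x ≈S y → y ≈S x
  ≈S-sym (p , r) = r , p

  ≈S-trans : ∀ {x y z} → x ≈S y → y ≈S z → x ≈S z
  ≈S-trans ((p , p') , (r , r')) ((s , s') , (t , t')) =
    ((λ v → s v ∘ p v) , (λ v → s' v ∘ p' v)) , ((λ v → r v ∘ t v) , (λ v → r' v ∘ t' v))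

  Label-resp : ∀ {X X' Y Y'} → X ≐ X' → Y ≐ Y' → ∀ j → Label X Y j → Label X' Y' j
  Label-resp (_ , X'⊆X) (Y⊆Y' , _) j ((v , v∈ , p) , old) =
    (v , Y⊆Y' v v∈ , p) , λ { (u , u∈ , r) → old (u , X'⊆X u u∈ , r) }

  LabelS-resp : ∀ {x x' y y'} → x ≈S x' → y ≈S y' → ∀ p → LabelS x y p → LabelS x' y' p
  LabelS-resp {x} {x'} {y} {y'} ((e₁ , e₂) , (e₃ , e₄)) ((f₁ , f₂) , (f₃ , f₄)) (a , b) (l , l') =
    Label-resp {fst x} {fst x'} {fst y} {fst y'} (e₁ , e₃) (f₁ , f₃) a l ,
    Label-resp {snd x} {snd x'} {snd y} {snd y'} (e₂ , e₄) (f₂ , f₄) b l'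

  -- The rank `r` is an index of its own, so that `advance` needs no arithmetic on `i ∸ m`.
  record Stage (m r : ℕ) : Set where
    constructor stage
    field
      frame₁ frame₂ : Frame m
      dim₁ : HasDim (ker frame₁) r
      dim₂ : HasDim (ker frame₂) r

    element : SegreElt
    element = ⟨ ker frame₁ , ker frame₂ , r , dim₁ , dim₂ ⟩

  open Stage

  advance : ∀ {m r} → Stage (suc m) r → (c d : Fin (suc m)) → Fin (q ℕ.^ toℕ c) → Fin (q ℕ.^ toℕ d) → Stage m (suc r)
  advance (stage F G dF dG) c d x y =
    stage (step F c (fun x)) (step G d (fun y)) (step-dim F c (fun x) dF) (step-dim G d (fun y) dG)

  LabelS-advance : ∀ {m r} (S : Stage (suc m) r) c d x y →
    LabelS (element S) (element (advance S c d x y)) (ρ (frame₁ S) c , ρ (frame₂ S) d)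
  LabelS-advance (stage F G _ _) c d x y = Label-ρ F c (fun x) , Label-ρ G d (fun y)

  LabelS-advance⇒ : ∀ {m r} (S : Stage (suc m) r) c d x y p →
    LabelS (element S) (element (advance S c d x y)) p → p ≡ (ρ (frame₁ S) c , ρ (frame₂ S) d)
  LabelS-advance⇒ (stage F G _ _) c d x y (j , j') (l , l') = cong₂ _,_ (Label⇒ρ F c (fun x) j l) (Label⇒ρ G d (fun y) j' l')

  chain : ∀ {m r a b} → Stage m r → Code m a b → ℕ → SegreElt
  chain S κ zero = element S
  -- A default past the end of the chain; only the positions up to `m` are ever compared.
  chain {zero}  S κ (suc k) = element S
  chain {suc m} S (c , d , _ , (x , y) , κ) (suc k) = chain (advance S c d x y) κ k

  chain-covers : ∀ {m r a b} (S : Stage m r) (κ : Code m a b) k → suc k ℕ.≤ m → chain S κ k ⋖S chain S κ (suc k)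
  chain-covers {suc m} S (c , d , _ , (x , y) , κ) zero _ =
    rank-suc⇒⋖S {element S} {element (advance S c d x y)}
      (ker⊆step (frame₁ S) c (fun x) , ker⊆step (frame₂ S) d (fun y)) refl
  chain-covers {suc m} S (c , d , _ , (x , y) , κ) (suc k) (s≤s k<m) = chain-covers (advance S c d x y) κ k k<m

  chain-top : ∀ {m r a b} (S : Stage m r) (κ : Code m a b) → IsMax (chain S κ m)
  -- The kernel of a map to the zero space is everything.
  chain-top {zero}  S κ z = (λ _ _ ()) , (λ _ _ ())
  chain-top {suc m} S (c , d , _ , (x , y) , κ) z = chain-top (advance S c d x y) κ z

  -- Consecutive labels are `ρ c` and `ρ (punchIn c c')`, and likewise for `d`. As `ρ` reflects the
  -- order, an ascent would give `c ≤ c'` and `d ≤ d'`, which the code forbids.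
  chain-descending : ∀ {m r a b} (S : Stage m r) (κ : Code m a b) k → suc (suc k) ℕ.≤ m → ∀ p p' →
    LabelS (chain S κ k) (chain S κ (suc k)) p →
    LabelS (chain S κ (suc k)) (chain S κ (suc (suc k))) p' → ¬ (p <P p')
  chain-descending {suc zero} S κ zero (s≤s ())
  chain-descending {suc (suc m)} S (c , d , _ , (x , y) , (c' , d' , ok , (x' , y') , κ)) zero _ p p' l l' ((le , le') , _)
    with LabelS-advance⇒ S c d x y p l | LabelS-advance⇒ (advance S c d x y) c' d' x' y' p' l'
  ... | refl | refl = T-noAscent⇒ (toℕ c) (toℕ d) (toℕ c') (toℕ d') ok
    (≤punchIn⇒≤ c c' (ρ-cancel-≤ (frame₁ S) le) , ≤punchIn⇒≤ d d' (ρ-cancel-≤ (frame₂ S) le'))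
  chain-descending {suc m} S (c , d , _ , (x , y) , κ) (suc k) (s≤s h) = chain-descending (advance S c d x y) κ k h

  chain-injective : ∀ {m r a b} (S : Stage m r) (κ κ' : Code m a b) →
    (∀ k → k ℕ.≤ m → chain S κ k ≈S chain S κ' k) → κ ≡ κ'
  chain-injective {zero}  S κ κ' e = refl
  chain-injective {suc m} S (c , d , ok , (x , y) , κ) (c' , d' , ok' , (x' , y') , κ') e
    with (e₁ , e₂) , (e₃ , e₄) ← e 1 (s≤s z≤n)
    with step-injective (frame₁ S) c c' x x' (e₁ , e₃) | step-injective (frame₂ S) d d' y y' (e₂ , e₄)
  ... | refl | refl = cong₂ (λ t κ → c , d , t , (x , y) , κ) (T-irrelevant ok ok')
    (chain-injective (advance S c d x y) κ κ' λ k k≤m → e (suc k) (s≤s k≤m))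

  -- The covers are decoded one at a time, following the chain only up to `_≈S_`. The last
  -- hypothesis carries the descent condition against the preceding step with ranks `a` and `b`,
  -- which is no longer part of `e`.
  chain-surjective : ∀ {m r} (S : Stage m r) (e : ℕ → SegreElt) → e 0 ≈S element S →
    (∀ k → suc k ℕ.≤ m → e k ⋖S e (suc k)) →
    (∀ k → suc (suc k) ℕ.≤ m → ∀ p p' → LabelS (e k) (e (suc k)) p →
      LabelS (e (suc k)) (e (suc (suc k))) p' → ¬ (p <P p')) →
    ∀ a b →
    (1 ℕ.≤ m → ∀ c d → LabelS (e 0) (e 1) (ρ (frame₁ S) c , ρ (frame₂ S) d) → ¬ (a ℕ.≤ toℕ c × b ℕ.≤ toℕ d)) →
    Σ (Code m a b) λ κ → ∀ k → k ℕ.≤ m → chain S κ k ≈S e k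
  chain-surjective {zero} S e e₀ covers desc a b first = tt , λ { zero z≤n → ≈S-sym {e 0} {element S} e₀ }
  chain-surjective {suc m} S e e₀@((sub , sub') , (sup , sup')) covers desc a b first =
    (c , d , T-noAscent⇐ a b (toℕ c) (toℕ d) (first (s≤s z≤n) c d label) , (x , y) , κ) , matches
    where
    F = frame₁ S
    G = frame₂ S
    cover = ⋖S⇒⊕ {e 0} {e 1} (covers 0 (s≤s z≤n))
    v = proj₁ cover
    u = proj₁ (proj₂ cover)
    v∉ : ¬ (fst (e 0) ∋ v)
    v∉ = proj₁ (proj₁ (proj₂ (proj₂ cover)))
    u∉ : ¬ (snd (e 0) ∋ u)
    u∉ = proj₁ (proj₂ (proj₂ (proj₂ cover)))
    codeF = step-cover F v (v∉ ∘ sup v)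
    codeG = step-cover G u (u∉ ∘ sup' u)
    c = proj₁ codeF
    d = proj₁ codeG
    x = proj₁ (proj₂ codeF)
    y = proj₁ (proj₂ codeG)
    S' : Stage m _
    S' = advance S c d x y
    ⊕-trans : ∀ {X X' Y Z v} → X ≐ X' → Y ≐ (X ⊕⟨ v ⟩) → (X' ⊕⟨ v ⟩) ≐ Z → Y ≐ Z
    ⊕-trans (XX' , X'X) (Y⊆ , ⊆Y) (⊆Z , Z⊆) =
      (λ t t∈ → let (a , r , r∈ , p) = Y⊆ t t∈ in ⊆Z t (a , r , XX' r r∈ , p)) ,
      (λ t t∈ → let (a , r , r∈ , p) = Z⊆ t t∈ in ⊆Y t (a , r , X'X r r∈ , p))
    e₁F : fst (e 1) ≐ ker (frame₁ S')
    e₁F = ⊕-trans {fst (e 0)} {ker F} {fst (e 1)} {ker (frame₁ S')} {v}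
      (sub , sup) (proj₂ (proj₁ (proj₂ (proj₂ cover)))) (proj₂ (proj₂ codeF))
    e₁G : snd (e 1) ≐ ker (frame₂ S')
    e₁G = ⊕-trans {snd (e 0)} {ker G} {snd (e 1)} {ker (frame₂ S')} {u}
      (sub' , sup') (proj₂ (proj₂ (proj₂ (proj₂ cover)))) (proj₂ (proj₂ codeG))
    e₁ : e 1 ≈S element S'
    e₁ = (proj₁ e₁F , proj₁ e₁G) , (proj₂ e₁F , proj₂ e₁G)
    label : LabelS (e 0) (e 1) (ρ F c , ρ G d)
    label = LabelS-resp {element S} {e 0} {element S'} {e 1}
      (≈S-sym {e 0} {element S} e₀) (≈S-sym {e 1} {element S'} e₁) _ (LabelS-advance S c d x y)
    -- Weak inequalities of both codes would make both labels rise strictly, contradicting `desc` at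
    -- the first two covers.
    first' : 1 ℕ.≤ m → ∀ c' d' → LabelS (e 1) (e 2) (ρ (frame₁ S') c' , ρ (frame₂ S') d') →
      ¬ (toℕ c ℕ.≤ toℕ c' × toℕ d ℕ.≤ toℕ d')
    first' 1≤m c' d' l (le , le') = desc 0 (s≤s 1≤m) _ _ label l
      ((ℕₚ.<⇒≤ c<c' , ℕₚ.<⇒≤ (ρ-mono G (≤⇒<punchIn d d' le'))) ,
        λ eq → ℕₚ.<-irrefl (cong (toℕ ∘ proj₁) eq) c<c')
      where
      c<c' : ρ F c Fin.< ρ F (punchIn c c')
      c<c' = ρ-mono F (≤⇒<punchIn c c' le)
    rest = chain-surjective S' (e ∘ suc) e₁
      (λ k h → covers (suc k) (s≤s h)) (λ k h → desc (suc k) (s≤s h)) (toℕ c) (toℕ d) first'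
    κ = proj₁ rest
    matches : ∀ k → k ℕ.≤ suc m → chain S (c , d , _ , (x , y) , κ) k ≈S e k
    matches zero    _         = ≈S-sym {e 0} {element S} e₀
    matches (suc k) (s≤s k≤m) = proj₂ rest k k≤m

  -- The number of descending maximal chains

  initial : Stage i 0
  initial = stage start start start-dim start-dim

  initial-bottom : IsMin (element initial)
  initial-bottom z = (λ v v≈0 → resp (fst z) (λ k → sym (v≈0 k)) (has0 (fst z))) ,
                     (λ v v≈0 → resp (snd z) (λ k → sym (v≈0 k)) (has0 (snd z)))

  DescendingChain : Set₁
  DescendingChain = Σ MaxChain Descending

  fromCode : Code i i i → DescendingChain
  fromCode κ = record { elt = chain initial κ ; bottom = initial-bottom ; top = chain-top initial κ ; covers = chain-covers initial κ }
    , chain-descending initial κ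

  toCode : (C : DescendingChain) → Σ (Code i i i) λ κ → ∀ k → k ℕ.≤ i → chain initial κ k ≈S elt (proj₁ C) k
  toCode (C , desc) = chain-surjective initial (elt C) (bottom C (element initial) , initial-bottom (elt C 0))
    -- No rank reaches `i`, so the fictitious previous ranks `i`, `i` leave the first step free.
    (covers C) desc i i λ _ c _ _ (i≤c , _) → ℕₚ.<⇒≱ (Finₚ.toℕ<n c) i≤c

  -- Two injections between finite sets suffice. A chain goes to its code, which determines it up to
  -- `_≈S_`; a code goes to the number of its chain, and `chain-injective` recovers it.
  NumDescChains⇒count : ∀ {n} → NumDescChains 𝔽 i n → n ≡ codeCount i i i
  NumDescChains⇒count {n} count = ℕₚ.≤-antisym
    (Finₚ.injective⇒≤ {f = Inverse.from (Fin-count i i i) ∘ code} λ {a} {b} eq →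
      let same : code a ≡ code b
          same = Injection.injective (↔⇒↣ (↔-sym (Fin-count i i i))) eq
      in trans (sym (Inverse.strictlyInverseˡ count a)) (trans (Inverse.to-cong count {nth a} {nth b} (λ k k≤i →
           ≈S-trans {elt (proj₁ (nth a)) k} {chain initial (code a) k} {elt (proj₁ (nth b)) k}
             (≈S-sym {chain initial (code a) k} {elt (proj₁ (nth a)) k} (proj₂ (toCode (nth a)) k k≤i))
             (subst (λ κ → chain initial κ k ≈S elt (proj₁ (nth b)) k) (sym same) (proj₂ (toCode (nth b)) k k≤i))))
         (Inverse.strictlyInverseˡ count b)))
    (Finₚ.injective⇒≤ {f = Inverse.to count ∘ fromCode ∘ Inverse.to (Fin-count i i i)} λ {a} {b} eq →
      let C = fromCode (Inverse.to (Fin-count i i i) a)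
          D = fromCode (Inverse.to (Fin-count i i i) b)
          C≈D = Setoid.trans (Lin.DescChains 𝔽 i) {C} {nth (Inverse.to count D)} {D}
                  (Setoid.sym (Lin.DescChains 𝔽 i) {nth (Inverse.to count D)} {C}
                    (Inverse.inverseʳ count {C} {Inverse.to count D} (sym eq)))
                  (Inverse.strictlyInverseʳ count D)
          same = chain-injective initial (Inverse.to (Fin-count i i i) a) (Inverse.to (Fin-count i i i) b) C≈D
      in Injection.injective (↔⇒↣ (Fin-count i i i)) same)
    where
    nth : Fin n → DescendingChain
    nth = Inverse.from count
    code : Fin n → Code i i i
    code a = proj₁ (toCode (nth a))

open import Data.Integer using (_*_) renaming (_^_ to _^ℤ_)

theorem4p7 : (q n : ℕ) → IsPrimePower q → 1 ≤ n → (𝔽 : FiniteField q) →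
    (W : ℕ → ℕ) → W 0 ≡ 1 → (∀ i → 1 ≤ i → NumDescChains 𝔽 i (W i)) →
    sumℤ n (λ i → (+ (qbinom q n i ^ 2)) * ((-1ℤ ^ℤ i) * (+ W i))) ≡ + 0
theorem4p7 q n _ 1≤n 𝔽 W W₀ chains = alternating-sum n 1≤n W W≡total
  where
  open Count q
  W≡total : ∀ i → W i ≡ total i
  W≡total zero    = W₀
  W≡total (suc i) = trans (Chains.NumDescChains⇒count 𝔽 (suc i) (chains (suc i) (s≤s z≤n))) (count-total (suc i))
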